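{- Every nice graph is algebraic $(1,6)$-choosable.
   Context: All graphs are finite and simple, with vertex set $V=\{1,\dots,n\}$; an edge is a $2$-element subset $\{i,j\}$ of $V$. For $i\in V$, $E(i)$ is the set of edges incident to $i$. An edge $\{i,j\}$ is isolated if both $i$ and $j$ have degree $1$; a graph is nice if it has no isolated edges. For a graph $G=(V,E)$ define the polynomial in variables $x_e$ ($e\in E$) $$P_G=\prod_{\{i,j\}\in E,\ i<j}\Big(\sum_{e\in E(i)}x_e-\sum_{e\in E(j)}x_e\Big)$$ (the empty product is $1$). For $K:E\to\mathbb{N}$ write $x^K=\prod_{e\in E}x_e^{K(e)}$, and let $\mathrm{mon}(P)$ be the set of monomials $x^K$ with nonzero coefficient in $P$. For a positive integer $b$, $G$ is algebraic $(1,b)$-choosable if there is $K:E\to\mathbb{N}$ with $\sum_{e\in E}K(e)=|E|$ and $K(e)\le b-1$ for all $e\in E$ such that $x^K\in\mathrm{mon}(P_G)$. -}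

module Defs where

open import Data.Fin using (Fin; _<_)
open import Data.Fin.Properties using (_≟_)
open import Data.Integer as ℤ using (ℤ; 0ℤ; 1ℤ)
open import Data.List using (List; []; _∷_; _++_; length; map; filter; foldr; allFin; cartesianProductWith)
open import Data.Nat as ℕ using (ℕ; _∸_; _≤_; NonZero)
import Data.Nat.Properties as ℕ
open import Data.Product using (∃-syntax; _×_; _,_; proj₁; proj₂)
open import Data.Sum using (_⊎_)
open import Data.Vec as Vec using (Vec; lookup; replicate; zipWith; _[_]≔_)
open import Data.Vec.Properties using (≡-dec)
open import Function.Definitions using (Injective)
open import Relation.Binary.PropositionalEquality using (_≡_; _≢_)
open import Relation.Nullary using (¬_; Dec)
open import Relation.Nullary.Decidable using (_⊎-dec_)

-- A finite simple graph on the vertex set Fin n.  The 2-element subset {i , j}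
-- is represented by the ordered pair (i , j) with i < j, and the edge set E by
-- an enumeration without repetition; thus Fin ∣E∣ indexes the edges.
record Graph (n : ℕ) : Set where
  field
    ∣E∣             : ℕ
    ends           : Fin ∣E∣ → Fin n × Fin n
    ends-ordered   : ∀ e → proj₁ (ends e) < proj₂ (ends e)
    ends-injective : Injective _≡_ _≡_ ends

  Edge : Set
  Edge = Fin ∣E∣

  lower upper : Edge → Fin n
  lower e = proj₁ (ends e)
  upper e = proj₂ (ends e)

  Incident : Fin n → Edge → Set
  Incident i e = i ≡ lower e ⊎ i ≡ upper e

  incident? : ∀ i e → Dec (Incident i e)
  incident? i e = (i ≟ lower e) ⊎-dec (i ≟ upper e)

  E[_] : Fin n → List Edge
  E[ i ] = filter (incident? i) (allFin ∣E∣)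

  degree : Fin n → ℕ
  degree i = length E[ i ]

  Isolated : Edge → Set
  Isolated e = degree (lower e) ≡ 1 × degree (upper e) ≡ 1

  Nice : Set
  Nice = ∀ e → ¬ Isolated e

-- The exponent vector K stands for the monomial x^K = ∏ₑ xₑ^K(e).
Monomial : ℕ → Set
Monomial m = Vec ℕ m

-- Polynomials over ℤ in the variables xₑ (e : Fin m), as formal sums of terms.
-- Terms with the same monomial may be repeated and may cancel, so only coeff
-- is meaningful, not the list itself.
Poly : ℕ → Set
Poly m = List (ℤ × Monomial m)

module _ {m : ℕ} where

  0ₚ 1ₚ : Poly m
  0ₚ = []
  1ₚ = (1ℤ , replicate m 0) ∷ []

  var : Fin m → Poly m
  var e = (1ℤ , replicate m 0 [ e ]≔ 1) ∷ []

  infixl 6 _+ₚ_ _-ₚ_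
  infixl 7 _*ₚ_

  _+ₚ_ _-ₚ_ _*ₚ_ : Poly m → Poly m → Poly m
  p +ₚ q = p ++ q
  p -ₚ q = p ++ map (λ (c , K) → ℤ.- c , K) q
  p *ₚ q = cartesianProductWith (λ (c , J) (d , K) → c ℤ.* d , zipWith ℕ._+_ J K) p q

  sumₚ productₚ : List (Poly m) → Poly m
  sumₚ     = foldr _+ₚ_ 0ₚ
  productₚ = foldr _*ₚ_ 1ₚ

  coeff : Monomial m → Poly m → ℤ
  coeff K p = foldr ℤ._+_ 0ℤ (map proj₁ (filter (λ t → ≡-dec ℕ._≟_ (proj₂ t) K) p))

  infix 4 _∈mon_

  _∈mon_ : Monomial m → Poly m → Set
  K ∈mon p = coeff K p ≢ 0ℤ

module _ {n : ℕ} (G : Graph n) where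
  open Graph G

  vertexSum : Fin n → Poly ∣E∣
  vertexSum i = sumₚ (map var E[ i ])

  graphPoly : Poly ∣E∣
  graphPoly = productₚ (map (λ e → vertexSum (lower e) -ₚ vertexSum (upper e)) (allFin ∣E∣))

infix 4 _isAlgebraic[1,_]Choosable

_isAlgebraic[1,_]Choosable : ∀ {n} → Graph n → (b : ℕ) → .{{NonZero b}} → Set
G isAlgebraic[1, b ]Choosable =
  ∃[ K ] Vec.sum K ≡ ∣E∣ × (∀ e → lookup K e ≤ b ∸ 1) × K ∈mon graphPoly G
  where open Graph G

{-# OPTIONS --safe #-}

-- Write s_v for the sum of the variables at v.  Up to a positive factor, the
-- coefficient of x^K in P_G = ∏ (s_i − s_j) is the permanent of the matrix whose
-- rows are the factors and in which the column of the variable xₑ occurs K(e)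
-- times.  By multilinearity it suffices to find |E| integer combinations of
-- variables in which every variable occurs at most 5 times altogether and whose
-- matrix has nonzero permanent.  The variable of an edge uv acts as the form
-- y_u + y_v on ∏ (y_i − y_j).
--
-- Let T be an independent set of maximum weight, where vertices of degree 1
-- weigh 2 and all others 3.  Then T is dominating; the vertices whose only
-- neighbour in T is w (the private neighbours of w) form a clique; and if w has
-- exactly one private neighbour, it has further neighbours, because otherwise w
-- could be replaced by that neighbour, which is not a leaf in a nice graph.
-- Order the vertices outside T first, then T.
--
-- * An edge uv with u < v outside T gets the column x_{uv} − x_{uv′} = y_v − y_{v′},
--   where v′ is the next neighbour of u; it exists since T is dominating.  These
--   columns make the matrix block triangular, with constant blocks, and reduce the
--   claim to the monomial ∏ y_w^{deg w} over w in T.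
-- * If u has neighbours w₁, …, w_k in T with k ≥ 2, take the cyclic differences
--   y_{w_i} − y_{w_{i+1}}, each twice.  If w has at least two private neighbours,
--   take 2 y_w = x_{uw} + x_{u′w} − x_{uu′} for u, u′ cyclically consecutive among
--   them.  The coefficient of the square of a product of differences at its
--   central monomial is up to sign a sum of squares, hence nonzero.  The degrees of
--   this monomial are at least those required, and expanding the permanent along
--   the excess rows selects the columns to be kept.

module Submission where

open import Algebra.Bundles using (CommutativeSemiring)
import Data.Bool as Bool
open import Data.Bool using (Bool; true; false; if_then_else_)
open import Data.Bool.Properties using (¬-not)
open import Data.Empty using (⊥; ⊥-elim)
open import Data.Fin as Fin using (Fin; zero; suc; toℕ)
open import Data.Fin.Properties using (_≟_; any?; toℕ-injective; toℕ<n; <-irrefl)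
open import Data.Integer as ℤ using (ℤ; 0ℤ; 1ℤ; -1ℤ) renaming (+_ to pos; -[1+_] to neg)
import Data.Integer.Properties as ℤ
open import Data.Integer.Tactic.RingSolver using (solve-∀)
open import Data.List using (List; []; _∷_; _++_; length; map; filter; concatMap; allFin; replicate; deduplicate)
open import Data.List.Extrema.Nat using (argmin; argmin-all; f[argmin]≤f[xs])
open import Data.List.Membership.Propositional using (_∈_)
open import Data.List.Membership.Propositional.Properties using (∈-map⁺; ∈-map⁻; ∈-++⁻; ∈-filter⁺; ∈-filter⁻; ∈-allFin; ∈-deduplicate⁺)
open import Data.List.Properties using (length-map; length-tabulate; map-++; map-∘; map-id; map-cong; ++-assoc; ++-identityʳ; filter-all; filter-none)
open import Data.List.Relation.Binary.Permutation.Propositional using (_↭_; refl; prep; swap; trans; ↭-sym; ↭-trans; ↭-refl; ↭-reflexive)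
open import Data.List.Relation.Binary.Permutation.Propositional.Properties using (∈-resp-↭; All-resp-↭; ↭-length; shift; ++⁺ˡ)
open import Data.List.Relation.Unary.All as All using (All; []; _∷_)
import Data.List.Relation.Unary.All.Properties as All
open import Data.List.Relation.Unary.AllPairs using ([]; _∷_)
open import Data.List.Relation.Unary.Any using (here; there)
import Data.List.Relation.Unary.Unique.DecPropositional.Properties as UniqueDec
open import Data.List.Relation.Unary.Unique.Propositional using (Unique)
open import Data.List.Relation.Unary.Unique.Propositional.Properties using (allFin⁺; filter⁺)
open import Data.Nat as ℕ using (ℕ; zero; suc; _!)
import Data.Nat.Properties as ℕ
open import Data.Product using (∃-syntax; _×_; _,_; proj₁; proj₂; map₂)
open import Data.Sum using (_⊎_; inj₁; inj₂)
open import Data.Vec as Vec using ([]; _∷_; zipWith; lookup; _[_]≔_)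
open import Data.Vec.Properties using (≡-dec; zipWith-assoc; zipWith-comm; zipWith-identityˡ; zipWith-identityʳ; lookup-zipWith; lookup-replicate; tabulate∘lookup; tabulate-cong; ∷-injective)
open import Function using (flip; _∘_)
open import Level using (0ℓ)
open import Relation.Binary.PropositionalEquality as ≡ using (_≡_; _≢_; cong; cong₂; sym; subst; module ≡-Reasoning)
open import Relation.Nullary using (¬_; Dec; yes; no; does)
open import Relation.Nullary.Decidable using (_×-dec_; _⊎-dec_; ¬?; decidable-stable)
open import Defs

-- Finite sums

module FiniteSum (R : CommutativeSemiring 0ℓ 0ℓ) where
  open CommutativeSemiring R renaming (refl to ≈-refl; sym to ≈-sym; trans to ≈-trans)
  open import Relation.Binary.Reasoning.Setoid setoid
  open import Algebra.Properties.CommutativeSemigroup +-commutativeSemigroup using (interchange)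
  open import Algebra.Properties.CommutativeSemigroup +-commutativeSemigroup public using () renaming (x∙yz≈y∙xz to +-leftComm)
  open import Algebra.Properties.CommutativeSemigroup *-commutativeSemigroup public using () renaming (x∙yz≈y∙xz to *-leftComm; interchange to *-interchange)

  private variable
    A B P Q : Set

  ∑ : List A → (A → Carrier) → Carrier
  ∑ []       f = 0#
  ∑ (x ∷ xs) f = f x + ∑ xs f

  𝟙 : Dec P → Carrier
  𝟙 d = if does d then 1# else 0#

  𝟙-yes : (d : Dec P) → P → 𝟙 d ≈ 1#
  𝟙-yes (yes _) _ = ≈-refl
  𝟙-yes (no ¬p) p = ⊥-elim (¬p p)

  𝟙-no : (d : Dec P) → ¬ P → 𝟙 d ≈ 0#
  𝟙-no (yes p) ¬p = ⊥-elim (¬p p)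
  𝟙-no (no _)  _  = ≈-refl

  𝟙-⇔ : (d : Dec P) (d′ : Dec Q) → (P → Q) → (Q → P) → 𝟙 d ≈ 𝟙 d′
  𝟙-⇔ (yes p) d′ f g = ≈-sym (𝟙-yes d′ (f p))
  𝟙-⇔ (no ¬p) d′ f g = ≈-sym (𝟙-no d′ (λ q → ¬p (g q)))

  ∑-cong-∈ : {f g : A → Carrier} (xs : List A) → (∀ {x} → x ∈ xs → f x ≈ g x) → ∑ xs f ≈ ∑ xs g
  ∑-cong-∈ []       h = ≈-refl
  ∑-cong-∈ (x ∷ xs) h = +-cong (h (here ≡.refl)) (∑-cong-∈ xs (λ m → h (there m)))

  ∑-cong : {f g : A → Carrier} (xs : List A) → (∀ x → f x ≈ g x) → ∑ xs f ≈ ∑ xs g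
  ∑-cong xs h = ∑-cong-∈ xs (λ {x} _ → h x)

  ∑-zero : (xs : List A) → ∑ xs (λ _ → 0#) ≈ 0#
  ∑-zero []       = ≈-refl
  ∑-zero (x ∷ xs) = ≈-trans (+-identityˡ _) (∑-zero xs)

  ∑-zero-∈ : {f : A → Carrier} (xs : List A) → (∀ {x} → x ∈ xs → f x ≈ 0#) → ∑ xs f ≈ 0#
  ∑-zero-∈ xs h = ≈-trans (∑-cong-∈ xs h) (∑-zero xs)

  ∑-+ : (xs : List A) (f g : A → Carrier) → ∑ xs (λ x → f x + g x) ≈ ∑ xs f + ∑ xs g
  ∑-+ []       f g = ≈-sym (+-identityˡ 0#)
  ∑-+ (x ∷ xs) f g = ≈-trans (+-congˡ (∑-+ xs f g)) (interchange _ _ _ _)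

  ∑-*ˡ : (xs : List A) (c : Carrier) (f : A → Carrier) → ∑ xs (λ x → c * f x) ≈ c * ∑ xs f
  ∑-*ˡ []       c f = ≈-sym (zeroʳ c)
  ∑-*ˡ (x ∷ xs) c f = ≈-trans (+-congˡ (∑-*ˡ xs c f)) (≈-sym (distribˡ c _ _))

  ∑-*ʳ : (xs : List A) (c : Carrier) (f : A → Carrier) → ∑ xs (λ x → f x * c) ≈ ∑ xs f * c
  ∑-*ʳ xs c f = ≈-trans (∑-cong xs (λ x → *-comm _ c)) (≈-trans (∑-*ˡ xs c f) (*-comm c _))

  ∑-swap : (xs : List A) (ys : List B) (f : A → B → Carrier) →
           ∑ xs (λ x → ∑ ys (f x)) ≈ ∑ ys (λ y → ∑ xs (λ x → f x y))
  ∑-swap []       ys f = ≈-sym (∑-zero ys)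
  ∑-swap (x ∷ xs) ys f = ≈-trans (+-congˡ (∑-swap xs ys f)) (≈-sym (∑-+ ys (f x) _))

  ∑-++ : (xs ys : List A) (f : A → Carrier) → ∑ (xs ++ ys) f ≈ ∑ xs f + ∑ ys f
  ∑-++ []       ys f = ≈-sym (+-identityˡ _)
  ∑-++ (x ∷ xs) ys f = ≈-trans (+-congˡ (∑-++ xs ys f)) (≈-sym (+-assoc _ _ _))

  ∑-map : (g : A → B) (xs : List A) (f : B → Carrier) → ∑ (map g xs) f ≈ ∑ xs (λ x → f (g x))
  ∑-map g []       f = ≈-refl
  ∑-map g (x ∷ xs) f = +-congˡ (∑-map g xs f)

  ∑-concatMap : (g : A → List B) (xs : List A) (f : B → Carrier) →
                ∑ (concatMap g xs) f ≈ ∑ xs (λ x → ∑ (g x) f)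
  ∑-concatMap g []       f = ≈-refl
  ∑-concatMap g (x ∷ xs) f = ≈-trans (∑-++ (g x) _ f) (+-congˡ (∑-concatMap g xs f))

  ∑-filter : {P : A → Set} (P? : ∀ x → Dec (P x)) (xs : List A) (f : A → Carrier) →
             ∑ (filter P? xs) f ≈ ∑ xs (λ x → 𝟙 (P? x) * f x)
  ∑-filter P? []       f = ≈-refl
  ∑-filter P? (x ∷ xs) f with P? x
  ... | yes _ = +-cong (≈-sym (*-identityˡ _)) (∑-filter P? xs f)
  ... | no  _ = ≈-trans (∑-filter P? xs f) (≈-sym (≈-trans (+-congʳ (zeroˡ _)) (+-identityˡ _)))

  ∑-↭ : {xs ys : List A} (f : A → Carrier) → xs ↭ ys → ∑ xs f ≈ ∑ ys f
  ∑-↭ f refl         = ≈-refl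
  ∑-↭ f (prep x p)   = +-congˡ (∑-↭ f p)
  ∑-↭ f (swap x y p) = ≈-trans (+-congˡ (+-congˡ (∑-↭ f p))) (+-leftComm _ _ _)
  ∑-↭ f (trans p q)  = ≈-trans (∑-↭ f p) (∑-↭ f q)

  ∑-const : (xs : List A) {c : Carrier} {f : A → Carrier} → (∀ {x} → x ∈ xs → f x ≈ c) →
            ∑ xs f ≈ ∑ xs (λ _ → 1#) * c
  ∑-const xs {c} h = ≈-trans (∑-cong-∈ xs (λ m → ≈-trans (h m) (≈-sym (*-identityˡ c)))) (∑-*ʳ xs c _)

  ∑-𝟙≟ : (_≟_ : (x y : A) → Dec (x ≡ y)) {xs : List A} {a : A} → Unique xs → a ∈ xs →
         (f : A → Carrier) → ∑ xs (λ x → 𝟙 (a ≟ x) * f x) ≈ f a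
  ∑-𝟙≟ _≟_ {x ∷ xs} {a} (x∉xs ∷ _) (here ≡.refl) f = begin
    𝟙 (a ≟ a) * f a + ∑ xs (λ x → 𝟙 (a ≟ x) * f x)
      ≈⟨ +-cong (*-congʳ (𝟙-yes (a ≟ a) ≡.refl))
           (∑-zero-∈ xs (λ {y} y∈ → ≈-trans (*-congʳ (𝟙-no (a ≟ y) (All.lookup x∉xs y∈))) (zeroˡ _))) ⟩
    1# * f a + 0#  ≈⟨ +-identityʳ _ ⟩
    1# * f a       ≈⟨ *-identityˡ _ ⟩
    f a            ∎
  ∑-𝟙≟ _≟_ {x ∷ xs} {a} (x∉xs ∷ u) (there a∈) f = begin
    𝟙 (a ≟ x) * f x + ∑ xs (λ x → 𝟙 (a ≟ x) * f x)
      ≈⟨ +-cong (*-congʳ (𝟙-no (a ≟ x) (λ a≡x → All.lookup x∉xs a∈ (≡.sym a≡x)))) (∑-𝟙≟ _≟_ u a∈ f) ⟩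
    0# * f x + f a  ≈⟨ +-congʳ (zeroˡ _) ⟩
    0# + f a        ≈⟨ +-identityˡ _ ⟩
    f a             ∎

open import Data.Integer using (_+_; _*_; _-_; -_; _^_)

module ℤ∑ = FiniteSum ℤ.+-*-commutativeSemiring
module ℕ∑ = FiniteSum ℕ.+-*-commutativeSemiring

module _ where
  open ℤ∑

  -- Permanents

  private variable
    A B X Y X′ Y′ : Set

  ∑≢0 : {f : A → ℤ} (xs : List A) → ∑ xs f ≢ 0ℤ → ∃[ x ] x ∈ xs × f x ≢ 0ℤ
  ∑≢0         []       h = ⊥-elim (h ≡.refl)
  ∑≢0 {f = f} (x ∷ xs) h with f x ℤ.≟ 0ℤ
  ... | no fx≢0  = x , here ≡.refl , fx≢0
  ... | yes fx≡0 with y , y∈ , fy≢0 ← ∑≢0 {f = f} xs (λ e → h (cong₂ _+_ fx≡0 e)) = y , there y∈ , fy≢0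

  *≢0ʳ : ∀ a {b} → a * b ≢ 0ℤ → b ≢ 0ℤ
  *≢0ʳ a h ≡.refl = h (ℤ.*-zeroʳ a)

  *-≢0 : ∀ {a b} → a ≢ 0ℤ → b ≢ 0ℤ → a * b ≢ 0ℤ
  *-≢0 {a} {b} p q r with ℤ.i*j≡0⇒i≡0∨j≡0 a r
  ... | inj₁ e = p e
  ... | inj₂ e = q e

  -- Entries are removed by position, so equal entries count separately. This is the index set of
  -- the Laplace expansion of a permanent.
  picks : List A → List (A × List A)
  picks []       = []
  picks (x ∷ xs) = (x , xs) ∷ map (map₂ (x ∷_)) (picks xs)

  ∑-picks : (x : A) (xs : List A) (f : A × List A → ℤ) →
            ∑ (picks (x ∷ xs)) f ≡ f (x , xs) + ∑ (picks xs) (λ (y , ys) → f (y , x ∷ ys))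
  ∑-picks x xs f = cong (f (x , xs) +_) (∑-map (map₂ (x ∷_)) (picks xs) f)

  picks-↭ : {xs : List A} {y : A} {ys : List A} → (y , ys) ∈ picks xs → xs ↭ y ∷ ys
  picks-↭ {xs = x ∷ xs} (here ≡.refl) = ↭-refl
  picks-↭ {xs = x ∷ xs} (there m) with (y , ys) , m′ , ≡.refl ← ∈-map⁻ _ m =
    ↭-trans (prep x (picks-↭ m′)) (swap x y ↭-refl)

  ∑-picks-1 : (xs : List A) → ∑ (picks xs) (λ _ → 1ℤ) ≡ pos (length xs)
  ∑-picks-1 []       = ≡.refl
  ∑-picks-1 (x ∷ xs) = ≡.trans (∑-picks x xs (λ _ → 1ℤ)) (cong (_+_ 1ℤ) (∑-picks-1 xs))

  ∑-picks-++ : (xs ys : List A) (f : A × List A → ℤ) →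
    ∑ (picks (xs ++ ys)) f ≡
    ∑ (picks xs) (λ (z , zs) → f (z , zs ++ ys)) + ∑ (picks ys) (λ (z , zs) → f (z , xs ++ zs))
  ∑-picks-++ []       ys f = sym (ℤ.+-identityˡ _)
  ∑-picks-++ (x ∷ xs) ys f = begin
    ∑ (picks (x ∷ xs ++ ys)) f
      ≡⟨ ∑-picks x (xs ++ ys) f ⟩
    f (x , xs ++ ys) + ∑ (picks (xs ++ ys)) (λ (z , zs) → f (z , x ∷ zs))
      ≡⟨ cong (f (x , xs ++ ys) +_) (∑-picks-++ xs ys _) ⟩
    f (x , xs ++ ys) + (∑ (picks xs) (λ (z , zs) → f (z , x ∷ zs ++ ys)) + rest)
      ≡⟨ ℤ.+-assoc (f (x , xs ++ ys)) _ _ ⟨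
    f (x , xs ++ ys) + ∑ (picks xs) (λ (z , zs) → f (z , x ∷ zs ++ ys)) + rest
      ≡⟨ cong (_+ rest) (∑-picks x xs (λ (z , zs) → f (z , zs ++ ys))) ⟨
    ∑ (picks (x ∷ xs)) (λ (z , zs) → f (z , zs ++ ys)) + rest ∎
    where
    open ≡-Reasoning
    rest = ∑ (picks ys) (λ (z , zs) → f (z , x ∷ xs ++ zs))

  -- Both sides run over the ordered pairs of distinct positions, and the remaining list does not
  -- depend on which of the two was removed first. This makes permanents independent of the order of
  -- the rows.
  ∑-picks² : (xs : List A) (f : A → A → List A → ℤ) →
    ∑ (picks xs) (λ (y , ys) → ∑ (picks ys) (λ (z , zs) → f y z zs)) ≡
    ∑ (picks xs) (λ (y , ys) → ∑ (picks ys) (λ (z , zs) → f z y zs))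
  ∑-picks² []       f = ≡.refl
  ∑-picks² (x ∷ xs) f = begin
    ∑ (picks (x ∷ xs)) (λ (y , ys) → ∑ (picks ys) (λ (z , zs) → f y z zs))
      ≡⟨ expand f ⟩
    ∑ (picks xs) (λ (z , zs) → f x z zs) + (∑ (picks xs) (λ (y , ys) → f y x ys) + rest f)
      ≡⟨ cong (λ u → ∑ (picks xs) (λ (z , zs) → f x z zs) + (∑ (picks xs) (λ (y , ys) → f y x ys) + u))
           (∑-picks² xs (λ y z zs → f y z (x ∷ zs))) ⟩
    ∑ (picks xs) (λ (z , zs) → f x z zs) + (∑ (picks xs) (λ (y , ys) → f y x ys) + rest (flip f))
      ≡⟨ +-leftComm (∑ (picks xs) (λ (z , zs) → f x z zs)) (∑ (picks xs) (λ (y , ys) → f y x ys)) (rest (flip f)) ⟩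
    ∑ (picks xs) (λ (y , ys) → f y x ys) + (∑ (picks xs) (λ (z , zs) → f x z zs) + rest (flip f))
      ≡⟨ expand (flip f) ⟨
    ∑ (picks (x ∷ xs)) (λ (y , ys) → ∑ (picks ys) (λ (z , zs) → f z y zs)) ∎
    where
    open ≡-Reasoning
    rest : (_ → _ → List _ → ℤ) → ℤ
    rest g = ∑ (picks xs) (λ (y , ys) → ∑ (picks ys) (λ (z , zs) → g y z (x ∷ zs)))
    expand : ∀ g → ∑ (picks (x ∷ xs)) (λ (y , ys) → ∑ (picks ys) (λ (z , zs) → g y z zs)) ≡
      ∑ (picks xs) (λ (z , zs) → g x z zs) + (∑ (picks xs) (λ (y , ys) → g y x ys) + rest g)
    expand g = ≡.trans (∑-picks x xs (λ (y , ys) → ∑ (picks ys) (λ (z , zs) → g y z zs)))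
      (cong (∑ (picks xs) (λ (z , zs) → g x z zs) +_)
        (≡.trans (∑-cong (picks xs) (λ (y , ys) → ∑-picks x ys (λ (z , zs) → g y z zs)))
          (∑-+ (picks xs) (λ (y , ys) → g y x ys) (λ (y , ys) → ∑ (picks ys) (λ (z , zs) → g y z (x ∷ zs))))))

  -- Expansion along the first row. Lists of different lengths give 0, so a nonzero value also
  -- certifies that the matrix is square.
  per : (X → Y → ℤ) → List X → List Y → ℤ
  per p []       []      = 1ℤ
  per p []       (_ ∷ _) = 0ℤ
  per p (x ∷ xs) ys      = ∑ (picks ys) (λ (y , ys′) → p x y * per p xs ys′)

  per-↭ : (p : X → Y → ℤ) {xs xs′ : List X} → xs ↭ xs′ → ∀ ys → per p xs ys ≡ per p xs′ ys
  per-↭ p refl         ys = ≡.refl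
  per-↭ p (prep x r)   ys = ∑-cong (picks ys) (λ (y , ys′) → cong (p x y *_) (per-↭ p r ys′))
  per-↭ p (trans r r′) ys = ≡.trans (per-↭ p r ys) (per-↭ p r′ ys)
  per-↭ p (swap {xs} {xs′} x x′ r) ys = begin
    ∑ (picks ys) (λ (y , ys′) → p x y * ∑ (picks ys′) (λ (z , zs) → p x′ z * per p xs zs))
      ≡⟨ inside x x′ ⟩
    ∑ (picks ys) (λ (y , ys′) → ∑ (picks ys′) (λ (z , zs) → p x y * (p x′ z * per p xs zs)))
      ≡⟨ ∑-picks² ys (λ y z zs → p x y * (p x′ z * per p xs zs)) ⟩
    ∑ (picks ys) (λ (y , ys′) → ∑ (picks ys′) (λ (z , zs) → p x z * (p x′ y * per p xs zs)))
      ≡⟨ ∑-cong (picks ys) (λ (y , ys′) → ∑-cong (picks ys′) (λ (z , zs) → *-leftComm (p x z) (p x′ y) _)) ⟩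
    ∑ (picks ys) (λ (y , ys′) → ∑ (picks ys′) (λ (z , zs) → p x′ y * (p x z * per p xs zs)))
      ≡⟨ inside x′ x ⟨
    ∑ (picks ys) (λ (y , ys′) → p x′ y * ∑ (picks ys′) (λ (z , zs) → p x z * per p xs zs))
      ≡⟨ ∑-cong (picks ys) (λ (y , ys′) → cong (p x′ y *_)
           (∑-cong (picks ys′) (λ (z , zs) → cong (p x z *_) (per-↭ p r zs)))) ⟩
    ∑ (picks ys) (λ (y , ys′) → p x′ y * ∑ (picks ys′) (λ (z , zs) → p x z * per p xs′ zs)) ∎
    where
    open ≡-Reasoning
    inside : ∀ u v → ∑ (picks ys) (λ (y , ys′) → p u y * ∑ (picks ys′) (λ (z , zs) → p v z * per p xs zs)) ≡
      ∑ (picks ys) (λ (y , ys′) → ∑ (picks ys′) (λ (z , zs) → p u y * (p v z * per p xs zs)))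
    inside u v = ∑-cong (picks ys) (λ (y , ys′) → sym (∑-*ˡ (picks ys′) (p u y) _))

  -- Induction on the rows: either the first row takes the column `y`, or a later one does, and then
  -- the two expansions commute.
  per-column : (p : X → Y → ℤ) (xs : List X) (y : Y) (ys : List Y) →
               per p xs (y ∷ ys) ≡ ∑ (picks xs) (λ (x , xs′) → p x y * per p xs′ ys)
  per-column p []       y ys = ≡.refl
  per-column p (x ∷ xs) y ys = begin
    ∑ (picks (y ∷ ys)) (λ (z , zs) → p x z * per p xs zs)
      ≡⟨ ∑-picks y ys (λ (z , zs) → p x z * per p xs zs) ⟩
    p x y * per p xs ys + ∑ (picks ys) (λ (z , zs) → p x z * per p xs (y ∷ zs))
      ≡⟨ cong (p x y * per p xs ys +_) (∑-cong (picks ys) (λ (z , zs) →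
           ≡.trans (cong (p x z *_) (per-column p xs y zs)) (sym (∑-*ˡ (picks xs) (p x z) _)))) ⟩
    p x y * per p xs ys + ∑ (picks ys) (λ (z , zs) → ∑ (picks xs) (λ (x′ , xs′) → p x z * (p x′ y * per p xs′ zs)))
      ≡⟨ cong (p x y * per p xs ys +_) (∑-swap (picks ys) (picks xs) _) ⟩
    p x y * per p xs ys + ∑ (picks xs) (λ (x′ , xs′) → ∑ (picks ys) (λ (z , zs) → p x z * (p x′ y * per p xs′ zs)))
      ≡⟨ cong (p x y * per p xs ys +_) (∑-cong (picks xs) (λ (x′ , xs′) →
           ≡.trans (∑-cong (picks ys) (λ (z , zs) → *-leftComm (p x z) (p x′ y) _)) (∑-*ˡ (picks ys) (p x′ y) _))) ⟩
    p x y * per p xs ys + ∑ (picks xs) (λ (x′ , xs′) → p x′ y * per p (x ∷ xs′) ys)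
      ≡⟨ ∑-picks x xs (λ (x′ , xs′) → p x′ y * per p xs′ ys) ⟨
    ∑ (picks (x ∷ xs)) (λ (x′ , xs′) → p x′ y * per p xs′ ys) ∎
    where open ≡-Reasoning

  per-transpose : (p : X → Y → ℤ) (xs : List X) (ys : List Y) → per p xs ys ≡ per (flip p) ys xs
  per-transpose p []       []       = ≡.refl
  per-transpose p (x ∷ xs) []       = ≡.refl
  per-transpose p xs       (y ∷ ys) =
    ≡.trans (per-column p xs y ys) (∑-cong (picks xs) (λ (x , xs′) → cong (p x y *_) (per-transpose p xs′ ys)))

  per-length : (p : X → Y → ℤ) (xs : List X) (ys : List Y) → per p xs ys ≢ 0ℤ → length xs ≡ length ys
  per-length p []       []      h = ≡.refl
  per-length p []       (_ ∷ _) h = ⊥-elim (h ≡.refl)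
  per-length p (x ∷ xs) ys      h with (y , ys′) , m , h′ ← ∑≢0 (picks ys) h =
    ≡.trans (cong suc (per-length p xs ys′ (*≢0ʳ (p x y) h′))) (sym (↭-length (picks-↭ m)))

  ∏ : List ℤ → ℤ
  ∏ []       = 1ℤ
  ∏ (x ∷ xs) = x * ∏ xs

  ∏≢0 : (f : A → ℤ) → (∀ x → f x ≢ 0ℤ) → ∀ xs → ∏ (map f xs) ≢ 0ℤ
  ∏≢0 f h []       = λ ()
  ∏≢0 f h (x ∷ xs) = *-≢0 (h x) (∏≢0 f h xs)

  -- Every term contains each row exactly once, so the row factors `σ` come out as one product. They
  -- will be the orientation signs of the factors of the graph polynomial.
  per-scale : (p : X → Y → ℤ) (q : X′ → Y′ → ℤ) (σ : X → ℤ) (g : X → X′) (h : Y → Y′)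
              (xs : List X) (ys : List Y) → (∀ {x y} → x ∈ xs → y ∈ ys → p x y ≡ σ x * q (g x) (h y)) →
              per p xs ys ≡ ∏ (map σ xs) * per q (map g xs) (map h ys)
  per-scale p q σ g h []       []      e = ≡.refl
  per-scale p q σ g h []       (_ ∷ _) e = ≡.refl
  per-scale p q σ g h (x ∷ xs) ys      e = begin
    ∑ (picks ys) (λ (y , ys′) → p x y * per p xs ys′)
      ≡⟨ ∑-cong-∈ (picks ys) (λ {(y , ys′)} m → ≡.trans
           (cong₂ _*_ (e (here ≡.refl) (∈-resp-↭ (↭-sym (picks-↭ m)) (here ≡.refl)))
             (per-scale p q σ g h xs ys′ (λ x∈ y∈ → e (there x∈) (∈-resp-↭ (↭-sym (picks-↭ m)) (there y∈)))))
           (*-interchange (σ x) (q (g x) (h y)) _ _)) ⟩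
    ∑ (picks ys) (λ (y , ys′) → σ x * ∏ (map σ xs) * (q (g x) (h y) * per q (map g xs) (map h ys′)))
      ≡⟨ ∑-*ˡ (picks ys) (σ x * ∏ (map σ xs)) _ ⟩
    σ x * ∏ (map σ xs) * ∑ (picks ys) (λ (y , ys′) → q (g x) (h y) * per q (map g xs) (map h ys′))
      ≡⟨ cong (σ x * ∏ (map σ xs) *_) (∑-picks-map ys _) ⟨
    σ x * ∏ (map σ xs) * ∑ (picks (map h ys)) (λ (y , ys′) → q (g x) y * per q (map g xs) ys′) ∎
    where
    open ≡-Reasoning
    ∑-picks-map : ∀ ys f → ∑ (picks (map h ys)) f ≡ ∑ (picks ys) (λ (y , ys′) → f (h y , map h ys′))
    ∑-picks-map []       f = ≡.refl
    ∑-picks-map (y ∷ ys) f = ≡.trans (∑-picks (h y) (map h ys) f)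
      (≡.trans (cong (f (h y , map h ys) +_) (∑-picks-map ys (λ (z , zs) → f (z , h y ∷ zs))))
        (sym (∑-picks y ys (λ (z , zs) → f (h z , map h zs)))))

  per-map : (p : X → Y → ℤ) (q : X′ → Y′ → ℤ) (g : X → X′) (h : Y → Y′) (xs : List X) (ys : List Y) →
            (∀ {x y} → x ∈ xs → y ∈ ys → p x y ≡ q (g x) (h y)) → per p xs ys ≡ per q (map g xs) (map h ys)
  per-map p q g h xs ys e = ≡.trans
    (per-scale p q (λ _ → 1ℤ) g h xs ys (λ {x} {y} x∈ y∈ → ≡.trans (e x∈ y∈) (sym (ℤ.*-identityˡ (q (g x) (h y))))))
    (≡.trans (cong (_* per q (map g xs) (map h ys)) (ones xs)) (ℤ.*-identityˡ (per q (map g xs) (map h ys))))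
    where
    ones : ∀ xs → ∏ (map (λ _ → 1ℤ) xs) ≡ 1ℤ
    ones []       = ≡.refl
    ones (x ∷ xs) = ≡.trans (ℤ.*-identityˡ (∏ (map (λ _ → 1ℤ) xs))) (ones xs)

  -- The rows `rs` vanish on `ds`, so in a nonzero term they take exactly the columns `cs`. The
  -- square block of ones then contributes the factorial of its size.
  per-block : (p : X → Y → ℤ) (rs ls : List X) (cs ds : List Y) → length rs ≡ length cs →
              (∀ {r c} → r ∈ rs → c ∈ cs → p r c ≡ 1ℤ) →
              (∀ {r d} → r ∈ rs → d ∈ ds → p r d ≡ 0ℤ) →
              per p (rs ++ ls) (cs ++ ds) ≡ pos (length rs !) * per p ls ds
  per-block p []       ls []       ds len one nil = sym (ℤ.*-identityˡ _)
  per-block p (r ∷ rs) ls cs       ds len one nil = begin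
    ∑ (picks (cs ++ ds)) (λ (y , ys) → p r y * per p (rs ++ ls) ys)
      ≡⟨ ∑-picks-++ cs ds _ ⟩
    ∑ (picks cs) (λ (c , cs′) → p r c * per p (rs ++ ls) (cs′ ++ ds)) + ∑ (picks ds) (λ (d , ds′) → p r d * per p (rs ++ ls) (cs ++ ds′))
      ≡⟨ cong₂ _+_
          (∑-const (picks cs) (λ {(c , cs′)} m → ≡.trans
            (cong₂ _*_ (one (here ≡.refl) (back m (here ≡.refl)))
               (per-block p rs ls cs′ ds (ℕ.suc-injective (≡.trans len (↭-length (picks-↭ m))))
                 (λ r∈ c∈ → one (there r∈) (back m (there c∈))) (λ r∈ → nil (there r∈))))
            (ℤ.*-identityˡ _)))
          (∑-zero-∈ (picks ds) (λ m → cong (_* per p (rs ++ ls) _) (nil (here ≡.refl) (back m (here ≡.refl))))) ⟩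
    ∑ (picks cs) (λ _ → 1ℤ) * (pos (length rs !) * per p ls ds) + 0ℤ
      ≡⟨ ℤ.+-identityʳ _ ⟩
    ∑ (picks cs) (λ _ → 1ℤ) * (pos (length rs !) * per p ls ds)
      ≡⟨ cong (_* (pos (length rs !) * per p ls ds)) (≡.trans (∑-picks-1 cs) (cong pos (sym len))) ⟩
    pos (suc (length rs)) * (pos (length rs !) * per p ls ds)
      ≡⟨ ℤ.*-assoc (pos (suc (length rs))) (pos (length rs !)) _ ⟨
    pos (suc (length rs)) * pos (length rs !) * per p ls ds
      ≡⟨ cong (_* per p ls ds) (ℤ.pos-* (suc (length rs)) (length rs !)) ⟨
    pos (suc (length rs) !) * per p ls ds ∎
    where
    open ≡-Reasoning
    back : ∀ {A : Set} {y z : A} {ys zs} → (y , ys) ∈ picks zs → z ∈ y ∷ ys → z ∈ zs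
    back m = ∈-resp-↭ (↭-sym (picks-↭ m))

  -- A nonzero expansion along the rows `xs` has a nonzero term. It gives some columns `zs` to these
  -- rows and leaves a nonzero minor.
  per-dropRows : (p : X → Y → ℤ) (xs ls : List X) (ys : List Y) → per p (xs ++ ls) ys ≢ 0ℤ →
                 ∃[ zs ] ∃[ ys′ ] ys ↭ zs ++ ys′ × per p ls ys′ ≢ 0ℤ
  per-dropRows p []       ls ys h = [] , ys , ↭-refl , h
  per-dropRows p (x ∷ xs) ls ys h
    with (y , ys₁) , m , h₁ ← ∑≢0 (picks ys) h
    with zs , ys′ , r , h′ ← per-dropRows p xs ls ys₁ (*≢0ʳ (p x y) h₁) =
    y ∷ zs , ys′ , ↭-trans (picks-↭ m) (prep y r) , h′

module _ where
  open ℤ∑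

  -- Polynomials as linear functionals

  infixl 6 _⊕_
  _⊕_ : ∀ {m} → Monomial m → Monomial m → Monomial m
  _⊕_ = zipWith ℕ._+_

  ⊕-assoc : ∀ {m} (I J K : Monomial m) → (I ⊕ J) ⊕ K ≡ I ⊕ (J ⊕ K)
  ⊕-assoc = zipWith-assoc ℕ.+-assoc

  ⊕-comm : ∀ {m} (J K : Monomial m) → J ⊕ K ≡ K ⊕ J
  ⊕-comm = zipWith-comm ℕ.+-comm

  ⊕-leftComm : ∀ {m} (I J K : Monomial m) → I ⊕ (J ⊕ K) ≡ J ⊕ (I ⊕ K)
  ⊕-leftComm I J K = ≡.trans (sym (⊕-assoc I J K)) (≡.trans (cong (_⊕ K) (⊕-comm I J)) (⊕-assoc J I K))

  ⊕-cancelˡ : ∀ {m} (I {J K} : Monomial m) → I ⊕ J ≡ I ⊕ K → J ≡ K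
  ⊕-cancelˡ []      {[]}    {[]}    e = ≡.refl
  ⊕-cancelˡ (i ∷ I) {j ∷ J} {k ∷ K} e with e₁ , e₂ ← ∷-injective e =
    cong₂ _∷_ (ℕ.+-cancelˡ-≡ i j k e₁) (⊕-cancelˡ I e₂)

  infix 4 _≟ᴹ_
  _≟ᴹ_ : ∀ {m} (J K : Monomial m) → Dec (J ≡ K)
  _≟ᴹ_ = ≡-dec ℕ._≟_

  𝟎 : ∀ {m} → Monomial m
  𝟎 = Vec.replicate _ 0

  ε : ∀ {m} → Fin m → Monomial m
  ε t = 𝟎 [ t ]≔ 1

  ⊕-identityˡ : ∀ {m} (K : Monomial m) → 𝟎 ⊕ K ≡ K
  ⊕-identityˡ = zipWith-identityˡ ℕ.+-identityˡ

  ⊕-identityʳ : ∀ {m} (K : Monomial m) → K ⊕ 𝟎 ≡ K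
  ⊕-identityʳ = zipWith-identityʳ ℕ.+-identityʳ

  occ : ∀ {m} → Fin m → List (Fin m) → ℕ
  occ s ss = ℕ∑.∑ ss (λ t → ℕ∑.𝟙 (s ≟ t))

  count : ∀ {m} → List (Fin m) → Monomial m
  count []       = 𝟎
  count (s ∷ ss) = ε s ⊕ count ss

  lookup-ε : ∀ {m} (s t : Fin m) → lookup (ε t) s ≡ ℕ∑.𝟙 (s ≟ t)
  lookup-ε {suc m} zero    zero    = ≡.refl
  lookup-ε {suc m} zero    (suc t) = ≡.refl
  lookup-ε {suc m} (suc s) zero    = lookup-replicate s 0
  lookup-ε {suc m} (suc s) (suc t) = ≡.trans (lookup-ε s t) (ℕ∑.𝟙-⇔ (s ≟ t) (suc s ≟ suc t) (cong suc) (λ { ≡.refl → ≡.refl }))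

  lookup-count : ∀ {m} (s : Fin m) ss → lookup (count ss) s ≡ occ s ss
  lookup-count s []       = lookup-replicate s 0
  lookup-count s (t ∷ ss) = ≡.trans (lookup-zipWith ℕ._+_ s (ε t) (count ss)) (cong₂ ℕ._+_ (lookup-ε s t) (lookup-count s ss))

  count-↭ : ∀ {m} {ss ts : List (Fin m)} → ss ↭ ts → count ss ≡ count ts
  count-↭ refl         = ≡.refl
  count-↭ (prep s r)   = cong (ε s ⊕_) (count-↭ r)
  count-↭ (swap s t r) = ≡.trans (cong (λ K → ε s ⊕ (ε t ⊕ K)) (count-↭ r)) (⊕-leftComm (ε s) (ε t) _)
  count-↭ (trans r q)  = ≡.trans (count-↭ r) (count-↭ q)

  sum-count : ∀ {m} (ss : List (Fin m)) → Vec.sum (count ss) ≡ length ss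
  sum-count {m} [] = sum-𝟎 m
    where
    sum-𝟎 : ∀ m → Vec.sum (Vec.replicate m 0) ≡ 0
    sum-𝟎 zero    = ≡.refl
    sum-𝟎 (suc m) = sum-𝟎 m
  sum-count (s ∷ ss) = ≡.trans (sum-ε s (count ss)) (cong suc (sum-count ss))
    where
    sum-ε : ∀ {m} (s : Fin m) K → Vec.sum (ε s ⊕ K) ≡ suc (Vec.sum K)
    sum-ε zero    (k ∷ K) = cong (λ J → suc (k ℕ.+ Vec.sum J)) (⊕-identityˡ K)
    sum-ε (suc s) (k ∷ K) = ≡.trans (cong (k ℕ.+_) (sum-ε s K)) (ℕ.+-suc k _)

  -- The linear extension of `φ` from monomials to polynomials. Term lists are not normalised, so
  -- products are studied through such functionals; `coeff` is the one that belongs to an indicator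
  -- function.
  ev : ∀ {m} → Poly m → (Monomial m → ℤ) → ℤ
  ev p φ = ∑ p (λ (c , K) → c * φ K)

  ev-cong : ∀ {m} (p : Poly m) {φ ψ : Monomial m → ℤ} → (∀ K → φ K ≡ ψ K) → ev p φ ≡ ev p ψ
  ev-cong p h = ∑-cong p (λ (c , K) → cong (c *_) (h K))

  ev-*ˡ : ∀ {m} (p : Poly m) k (φ : Monomial m → ℤ) → ev p (λ K → k * φ K) ≡ k * ev p φ
  ev-*ˡ p k φ = ≡.trans (∑-cong p (λ (c , K) → *-leftComm c k (φ K))) (∑-*ˡ p k (λ (c , K) → c * φ K))

  ev-*ₚ : ∀ {m} (p q : Poly m) φ → ev (p *ₚ q) φ ≡ ev p (λ J → ev q (λ K → φ (J ⊕ K)))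
  ev-*ₚ []            q φ = ≡.refl
  ev-*ₚ ((c , J) ∷ p) q φ = ≡.trans (∑-++ (map _ q) (p *ₚ q) _)
    (cong₂ _+_ (≡.trans (∑-map _ q _) (≡.trans (∑-cong q (λ (d , K) → ℤ.*-assoc c d (φ (J ⊕ K)))) (∑-*ˡ q c _)))
               (ev-*ₚ p q φ))

  coeff-ev : ∀ {m} (K : Monomial m) p → coeff K p ≡ ev p (λ J → 𝟙 (J ≟ᴹ K))
  coeff-ev K []            = ≡.refl
  coeff-ev K ((c , J) ∷ p) with J ≟ᴹ K
  ... | yes _ = cong₂ _+_ (sym (ℤ.*-identityʳ c)) (coeff-ev K p)
  ... | no  _ = ≡.trans (coeff-ev K p) (sym (≡.trans (cong (_+ _) (ℤ.*-zeroʳ c)) (ℤ.+-identityˡ _)))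

  LinForm : ℕ → Set
  LinForm m = List (ℤ × Fin m)

  lin : ∀ {m} → LinForm m → Poly m
  lin = map (map₂ ε)

  prod : ∀ {m} → List (LinForm m) → Poly m
  prod L = productₚ (map lin L)

  ev-[] : ∀ {m} (φ : Monomial m → ℤ) → ev (prod []) φ ≡ φ 𝟎
  ev-[] φ = ≡.trans (ℤ.+-identityʳ _) (ℤ.*-identityˡ _)

  ev-∷ : ∀ {m} (ℓ : LinForm m) L φ → ev (prod (ℓ ∷ L)) φ ≡ ∑ ℓ (λ (c , t) → c * ev (prod L) (λ K → φ (ε t ⊕ K)))
  ev-∷ ℓ L φ = ≡.trans (ev-*ₚ (lin ℓ) (prod L) φ) (∑-map (map₂ ε) ℓ _)

  ev-++ : ∀ {m} (L M : List (LinForm m)) φ →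
          ev (prod (L ++ M)) φ ≡ ev (prod L) (λ J → ev (prod M) (λ K → φ (J ⊕ K)))
  ev-++ []      M φ = sym (≡.trans (ev-[] (λ J → ev (prod M) (λ K → φ (J ⊕ K))))
    (ev-cong (prod M) (λ K → cong φ (⊕-identityˡ K))))
  ev-++ (ℓ ∷ L) M φ = begin
    ev (prod (ℓ ∷ L ++ M)) φ
      ≡⟨ ev-∷ ℓ (L ++ M) φ ⟩
    ∑ ℓ (λ (c , t) → c * ev (prod (L ++ M)) (λ K → φ (ε t ⊕ K)))
      ≡⟨ ∑-cong ℓ (λ (c , t) → cong (c *_) (≡.trans (ev-++ L M (λ K → φ (ε t ⊕ K)))
           (ev-cong (prod L) (λ J → ev-cong (prod M) (λ K → cong φ (sym (⊕-assoc (ε t) J K))))))) ⟩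
    ∑ ℓ (λ (c , t) → c * ev (prod L) (λ J → ev (prod M) (λ K → φ ((ε t ⊕ J) ⊕ K))))
      ≡⟨ ev-∷ ℓ L (λ J → ev (prod M) (λ K → φ (J ⊕ K))) ⟨
    ev (prod (ℓ ∷ L)) (λ J → ev (prod M) (λ K → φ (J ⊕ K))) ∎
    where open ≡-Reasoning

  -- mult ss is the product of the factorials of the multiplicities in ss.
  mult : ∀ {m} → List (Fin m) → ℤ
  mult []       = 1ℤ
  mult (s ∷ ss) = pos (suc (occ s ss)) * mult ss

  mult≢0 : ∀ {m} (ss : List (Fin m)) → mult ss ≢ 0ℤ
  mult≢0 []       = λ ()
  mult≢0 (s ∷ ss) = *-≢0 {pos (suc (occ s ss))} (λ ()) (mult≢0 ss)

  -- If `t` occurs k ≥ 1 times in `ss`, then there are k ways to remove it, and each divides `mult`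
  -- by k. For k = 0 the left side is 0, whence the hypothesis on `X`.
  ∑-picks-mult : ∀ {m} (t : Fin m) ss X → (occ t ss ≡ 0 → X ≡ 0ℤ) →
                 ∑ (picks ss) (λ (s , ss′) → 𝟙 (t ≟ s) * (mult ss′ * X)) ≡ mult ss * X
  ∑-picks-mult t []       X h = ≡.trans (sym (h ≡.refl)) (sym (ℤ.*-identityˡ X))
  ∑-picks-mult t (s ∷ ss) X h = begin
    ∑ (picks (s ∷ ss)) (λ (u , us) → 𝟙 (t ≟ u) * (mult us * X))
      ≡⟨ ∑-picks s ss (λ (u , us) → 𝟙 (t ≟ u) * (mult us * X)) ⟩
    𝟙 (t ≟ s) * (mult ss * X) + ∑ (picks ss) (λ (u , us) → 𝟙 (t ≟ u) * (mult (s ∷ us) * X))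
      ≡⟨ cases (t ≟ s) ⟩
    mult (s ∷ ss) * X ∎
    where
    open ≡-Reasoning
    rearrange : ∀ a b c → a * b * c ≡ b * (a * c)
    rearrange a b c = ≡.trans (ℤ.*-assoc a b c) (*-leftComm a b c)
    -- The head `s` contributes to `mult (s ∷ us)` a factor `k` that is the same for every pick of
    -- `t`, so `k` is absorbed into `X`.
    term : ∀ (k : ℤ) → (∀ {us} → (t , us) ∈ picks ss → pos (suc (occ s us)) ≡ k) → (occ t ss ≡ 0 → k * X ≡ 0ℤ) →
           ∑ (picks ss) (λ (u , us) → 𝟙 (t ≟ u) * (mult (s ∷ us) * X)) ≡ mult ss * (k * X)
    term k e h′ = ≡.trans (∑-cong-∈ (picks ss) (λ {(u , us)} m → one u us m)) (∑-picks-mult t ss (k * X) h′)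
      where
      one : ∀ u us → (u , us) ∈ picks ss → 𝟙 (t ≟ u) * (mult (s ∷ us) * X) ≡ 𝟙 (t ≟ u) * (mult us * (k * X))
      one u us m with t ≟ u
      ... | no  _      = ≡.refl
      ... | yes ≡.refl = cong (1ℤ *_) (≡.trans (cong (λ z → z * mult us * X) (e m)) (rearrange k (mult us) X))
    cases : (d : Dec (t ≡ s)) → 𝟙 d * (mult ss * X) + ∑ (picks ss) (λ (u , us) → 𝟙 (t ≟ u) * (mult (s ∷ us) * X))
            ≡ mult (s ∷ ss) * X
    cases (yes ≡.refl) = begin
      1ℤ * (mult ss * X) + ∑ (picks ss) (λ (u , us) → 𝟙 (t ≟ u) * (mult (t ∷ us) * X))
        ≡⟨ cong₂ _+_ (ℤ.*-identityˡ (mult ss * X)) (term (pos (occ t ss))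
             (λ {us} m → cong pos (sym (≡.trans (ℕ∑.∑-↭ (λ u → ℕ∑.𝟙 (t ≟ u)) (picks-↭ m)) (cong (ℕ._+ occ t us) (ℕ∑.𝟙-yes (t ≟ t) ≡.refl)))))
             (λ z → cong (λ k → pos k * X) z)) ⟩
      mult ss * X + mult ss * (pos (occ t ss) * X)
        ≡⟨ cong (mult ss * X +_) (*-leftComm (mult ss) (pos (occ t ss)) X) ⟩
      mult ss * X + pos (occ t ss) * (mult ss * X)
        ≡⟨ ℤ.suc-* (pos (occ t ss)) (mult ss * X) ⟨
      pos (suc (occ t ss)) * (mult ss * X)
        ≡⟨ ℤ.*-assoc (pos (suc (occ t ss))) (mult ss) X ⟨
      mult (t ∷ ss) * X ∎
    cases (no t≢s) = begin
      0ℤ * (mult ss * X) + ∑ (picks ss) (λ (u , us) → 𝟙 (t ≟ u) * (mult (s ∷ us) * X))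
        ≡⟨ ℤ.+-identityˡ _ ⟩
      ∑ (picks ss) (λ (u , us) → 𝟙 (t ≟ u) * (mult (s ∷ us) * X))
        ≡⟨ term (pos (suc (occ s ss)))
             (λ {us} m → cong (pos ∘ suc) (sym (≡.trans (ℕ∑.∑-↭ (λ u → ℕ∑.𝟙 (s ≟ u)) (picks-↭ m)) (cong (ℕ._+ occ s us) (ℕ∑.𝟙-no (s ≟ t) (t≢s ∘ sym))))))
             (λ z → ≡.trans (cong (pos (suc (occ s ss)) *_) (h (cong₂ ℕ._+_ (ℕ∑.𝟙-no (t ≟ s) t≢s) z))) (ℤ.*-zeroʳ (pos (suc (occ s ss))))) ⟩
      mult ss * (pos (suc (occ s ss)) * X)
        ≡⟨ rearrange (pos (suc (occ s ss))) (mult ss) X ⟨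
      mult (s ∷ ss) * X ∎

  coord : ∀ {m} → LinForm m → Fin m → ℤ
  coord ℓ s = ∑ ℓ (λ (c , t) → c * 𝟙 (t ≟ s))

  -- Expanding the product chooses one variable from every factor. A choice with monomial `count ss`
  -- matches the columns `ss` in `mult ss` ways, because equal columns may be permuted.
  per-coeff : ∀ {m} (L : List (LinForm m)) (ss : List (Fin m)) →
              per coord L ss ≡ mult ss * coeff (count ss) (prod L)
  per-coeff L ss = ≡.trans (go L ss) (cong (mult ss *_) (sym (coeff-ev (count ss) (prod L))))
    where
    open ≡-Reasoning
    go : ∀ {m} (L : List (LinForm m)) (ss : List (Fin m)) →
         per coord L ss ≡ mult ss * ev (prod L) (λ J → 𝟙 (J ≟ᴹ count ss))
    go {m} []  []       = sym (≡.trans (ℤ.*-identityˡ (ev (prod []) δ)) (≡.trans (ev-[] δ) (𝟙-yes (𝟎 {m} ≟ᴹ 𝟎) ≡.refl)))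
      where
      δ : Monomial m → ℤ
      δ = λ J → 𝟙 (J ≟ᴹ 𝟎)
    go []      (s ∷ ss) = sym (≡.trans (cong (mult (s ∷ ss) *_) (≡.trans (ev-[] (λ J → 𝟙 (J ≟ᴹ count (s ∷ ss))))
                            (𝟙-no (𝟎 ≟ᴹ count (s ∷ ss)) 𝟎≢))) (ℤ.*-zeroʳ (mult (s ∷ ss))))
      where
      𝟎≢ : 𝟎 ≢ count (s ∷ ss)
      𝟎≢ e with ≡.trans (sym (lookup-replicate s 0)) (≡.trans (cong (λ K → lookup K s) e)
                  (≡.trans (lookup-count s (s ∷ ss)) (cong (ℕ._+ occ s ss) (ℕ∑.𝟙-yes (s ≟ s) ≡.refl))))
      ... | ()
    go (ℓ ∷ L) ss = begin
      ∑ (picks ss) (λ (s , ss′) → coord ℓ s * per coord L ss′)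
        ≡⟨ ∑-cong (picks ss) (λ (s , ss′) → sym (∑-*ʳ ℓ (per coord L ss′) (λ (c , t) → c * 𝟙 (t ≟ s)))) ⟩
      ∑ (picks ss) (λ (s , ss′) → ∑ ℓ (λ (c , t) → c * 𝟙 (t ≟ s) * per coord L ss′))
        ≡⟨ ∑-swap (picks ss) ℓ (λ (s , ss′) (c , t) → c * 𝟙 (t ≟ s) * per coord L ss′) ⟩
      ∑ ℓ (λ (c , t) → ∑ (picks ss) (λ (s , ss′) → c * 𝟙 (t ≟ s) * per coord L ss′))
        ≡⟨ ∑-cong ℓ (λ (c , t) → ≡.trans (∑-cong-∈ (picks ss) (λ {(s , ss′)} m →
             ≡.trans (ℤ.*-assoc c (𝟙 (t ≟ s)) (per coord L ss′)) (cong (c *_) (one t s ss′ m))))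
             (∑-*ˡ (picks ss) c (λ (s , ss′) → 𝟙 (t ≟ s) * (mult ss′ * X t)))) ⟩
      ∑ ℓ (λ (c , t) → c * ∑ (picks ss) (λ (s , ss′) → 𝟙 (t ≟ s) * (mult ss′ * X t)))
        ≡⟨ ∑-cong ℓ (λ (c , t) → ≡.trans (cong (c *_) (∑-picks-mult t ss (X t) (X≡0 t))) (*-leftComm c (mult ss) (X t))) ⟩
      ∑ ℓ (λ (c , t) → mult ss * (c * X t))
        ≡⟨ ∑-*ˡ ℓ (mult ss) (λ (c , t) → c * X t) ⟩
      mult ss * ∑ ℓ (λ (c , t) → c * X t)
        ≡⟨ cong (mult ss *_) (ev-∷ ℓ L (λ J → 𝟙 (J ≟ᴹ count ss))) ⟨
      mult ss * ev (prod (ℓ ∷ L)) (λ J → 𝟙 (J ≟ᴹ count ss)) ∎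
      where
      X : Fin _ → ℤ
      X t = ev (prod L) (λ K → 𝟙 (ε t ⊕ K ≟ᴹ count ss))
      -- A monomial divisible by the variable `t` cannot be `count ss` when `t` does not occur in
      -- `ss`.
      X≡0 : ∀ t → occ t ss ≡ 0 → X t ≡ 0ℤ
      X≡0 t z = ∑-zero-∈ (prod L) (λ {(c , K)} _ → ≡.trans (cong (c *_) (𝟙-no (ε t ⊕ K ≟ᴹ count ss) (λ e →
        absurd (≡.trans (sym (≡.trans (lookup-zipWith ℕ._+_ t (ε t) K) (cong (ℕ._+ lookup K t) (≡.trans (lookup-ε t t) (ℕ∑.𝟙-yes (t ≟ t) ≡.refl)))))
                  (≡.trans (cong (λ J → lookup J t) e) (≡.trans (lookup-count t ss) z)))))) (ℤ.*-zeroʳ c))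
        where
        absurd : ∀ {k} → suc k ≢ 0
        absurd ()
      one : ∀ t s ss′ → (s , ss′) ∈ picks ss → 𝟙 (t ≟ s) * per coord L ss′ ≡ 𝟙 (t ≟ s) * (mult ss′ * X t)
      one t s ss′ m with t ≟ s
      ... | no  _      = ≡.refl
      ... | yes ≡.refl = cong (1ℤ *_) (≡.trans (go L ss′) (cong (mult ss′ *_) (ev-cong (prod L) (λ K →
              𝟙-⇔ (K ≟ᴹ count ss′) (ε t ⊕ K ≟ᴹ count ss)
                (λ e → ≡.trans (cong (ε t ⊕_) e) (sym (count-↭ (picks-↭ m))))
                (λ e → ⊕-cancelˡ (ε t) (≡.trans e (count-↭ (picks-↭ m))))))))

  combine : {S X : Set} → (S → X → ℤ) → List (ℤ × S) → X → ℤ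
  combine a c x = ∑ c (λ (k , s) → k * a s x)

  unit : {S : Set} → S → List (ℤ × S)
  unit s = (1ℤ , s) ∷ []

  -- By multilinearity in the rows.
  per-select : {S X : Set} (a : S → X → ℤ) (cs : List (List (ℤ × S))) (xs : List X) → per (combine a) cs xs ≢ 0ℤ →
               ∃[ ss ] per a ss xs ≢ 0ℤ × (∀ (μ : S → ℕ) → ℕ∑.∑ ss μ ℕ.≤ ℕ∑.∑ cs (λ c → ℕ∑.∑ c (μ ∘ proj₂)))
  per-select {S} {X} a cs xs h with go cs [] (subst (λ z → per (combine a) z xs ≢ 0ℤ) (sym (++-identityʳ cs)) h)
    where
    linear : ∀ c (zs : List (List (ℤ × S))) xs → per (combine a) (c ∷ zs) xs ≡ ∑ c (λ (k , s) → k * per (combine a) (unit s ∷ zs) xs)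
    linear c zs xs = begin
      ∑ (picks xs) (λ (x , xs′) → combine a c x * per (combine a) zs xs′)
        ≡⟨ ∑-cong (picks xs) (λ (x , xs′) → sym (∑-*ʳ c (per (combine a) zs xs′) (λ (k , s) → k * a s x))) ⟩
      ∑ (picks xs) (λ (x , xs′) → ∑ c (λ (k , s) → k * a s x * per (combine a) zs xs′))
        ≡⟨ ∑-swap (picks xs) c (λ (x , xs′) (k , s) → k * a s x * per (combine a) zs xs′) ⟩
      ∑ c (λ (k , s) → ∑ (picks xs) (λ (x , xs′) → k * a s x * per (combine a) zs xs′))
        ≡⟨ ∑-cong c (λ (k , s) → ≡.trans (∑-cong (picks xs) (λ (x , xs′) →
             ≡.trans (ℤ.*-assoc k (a s x) (per (combine a) zs xs′)) (cong (λ z → k * (z * per (combine a) zs xs′))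
               (sym (≡.trans (ℤ.+-identityʳ (1ℤ * a s x)) (ℤ.*-identityˡ (a s x)))))))
             (∑-*ˡ (picks xs) k (λ (x , xs′) → combine a (unit s) x * per (combine a) zs xs′))) ⟩
      ∑ c (λ (k , s) → k * per (combine a) (unit s ∷ zs) xs) ∎
      where open ≡-Reasoning
    single : ∀ ss → per (combine a) (map unit ss) xs ≢ 0ℤ → per a ss xs ≢ 0ℤ
    single ss h e = h (≡.trans (cong (per (combine a) (map unit ss)) (sym (map-id xs)))
      (≡.trans (sym (per-map a (combine a) unit (λ x → x) ss xs
        (λ {s} {x} _ _ → sym (≡.trans (ℤ.+-identityʳ (1ℤ * a s x)) (ℤ.*-identityˡ (a s x)))))) e))
    -- One term of each combination is kept in turn. The kept ones, `ts`, are carried along as unit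
    -- combinations until no other rows remain.
    go : ∀ cs ts → per (combine a) (cs ++ map unit ts) xs ≢ 0ℤ →
         ∃[ ss ] per a ss xs ≢ 0ℤ × (∀ (μ : S → ℕ) → ℕ∑.∑ ss μ ℕ.≤ ℕ∑.∑ cs (λ c → ℕ∑.∑ c (μ ∘ proj₂)) ℕ.+ ℕ∑.∑ ts μ)
    go []       ts h = ts , single ts h , λ μ → ℕ.≤-refl
    go (c ∷ cs) ts h
      with (k , s) , m , h₁ ← ∑≢0 c (subst (_≢ 0ℤ) (linear c (cs ++ map unit ts) xs) h)
      with ss , h₂ , bound ← go cs (s ∷ ts) (subst (_≢ 0ℤ) (sym (per-↭ (combine a) (shift (unit s) cs (map unit ts)) xs)) (*≢0ʳ k h₁))
      = ss , h₂ , λ μ → let open ℕ.≤-Reasoning; rest = ℕ∑.∑ cs (λ c → ℕ∑.∑ c (μ ∘ proj₂)) in begin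
        ℕ∑.∑ ss μ                           ≤⟨ bound μ ⟩
        rest ℕ.+ (μ s ℕ.+ ℕ∑.∑ ts μ)        ≡⟨ ℕ∑.+-leftComm rest (μ s) _ ⟩
        μ s ℕ.+ (rest ℕ.+ ℕ∑.∑ ts μ)        ≤⟨ ℕ.+-monoˡ-≤ _ (term μ m) ⟩
        ℕ∑.∑ c (μ ∘ proj₂) ℕ.+ (rest ℕ.+ ℕ∑.∑ ts μ) ≡⟨ ℕ.+-assoc (ℕ∑.∑ c (μ ∘ proj₂)) rest _ ⟨
        ℕ∑.∑ c (μ ∘ proj₂) ℕ.+ rest ℕ.+ ℕ∑.∑ ts μ ∎
      where
      term : ∀ (μ : S → ℕ) {c k s} → (k , s) ∈ c → μ s ℕ.≤ ℕ∑.∑ c (μ ∘ proj₂)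
      term μ (here ≡.refl) = ℕ.m≤m+n _ _
      term μ (there {x = x} m) = ℕ.≤-trans (term μ m) (ℕ.m≤n+m _ (μ (proj₂ x)))
  ... | ss , h₁ , bound = ss , h₁ , λ μ → subst (ℕ∑.∑ ss μ ℕ.≤_) (ℕ.+-identityʳ _) (bound μ)

  -- Products of differences

  ∑-squares : {A : Set} (f : A → ℤ) (xs : List A) → ∑ xs (λ x → f x * f x) ≡ 0ℤ → ∀ {x} → x ∈ xs → f x ≡ 0ℤ
  ∑-squares f xs e m = ℤ.∣i∣≡0⇒i≡0 (square-zero (ℕ.n≤0⇒n≡0 (subst (_ ℕ.≤_) (ℤ.+-injective (≡.trans (sym (total xs)) e)) (term xs m))))
    where
    square : ∀ i → i * i ≡ pos (ℤ.∣ i ∣ ℕ.* ℤ.∣ i ∣)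
    square (pos n) = sym (ℤ.pos-* n n)
    square (neg n) = ≡.refl
    square-zero : ∀ {k} → k ℕ.* k ≡ 0 → k ≡ 0
    square-zero {zero} e = ≡.refl
    total : ∀ xs → ∑ xs (λ x → f x * f x) ≡ pos (ℕ∑.∑ xs (λ x → ℤ.∣ f x ∣ ℕ.* ℤ.∣ f x ∣))
    total []       = ≡.refl
    total (x ∷ xs) = cong₂ _+_ (square (f x)) (total xs)
    term : ∀ xs {x} → x ∈ xs → ℤ.∣ f x ∣ ℕ.* ℤ.∣ f x ∣ ℕ.≤ ℕ∑.∑ xs (λ x → ℤ.∣ f x ∣ ℕ.* ℤ.∣ f x ∣)
    term (x ∷ xs) (here ≡.refl) = ℕ.m≤m+n _ _
    term (x ∷ xs) (there m)     = ℕ.≤-trans (term xs m) (ℕ.m≤n+m _ _)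

  module _ {m : ℕ} where

    support : Poly m → List (Monomial m)
    support p = deduplicate _≟ᴹ_ (map proj₂ p)

    -- Collecting like terms: a functional sees only the coefficients and not the list of terms.
    ev-support : ∀ (p : Poly m) φ → ev p φ ≡ ∑ (support p) (λ J → coeff J p * φ J)
    ev-support p φ = sym (begin
      ∑ R (λ J → coeff J p * φ J)
        ≡⟨ ∑-cong R (λ J → ≡.trans (cong (_* φ J) (coeff-ev J p)) (sym (∑-*ʳ p (φ J) (λ (c , K) → c * 𝟙 (K ≟ᴹ J))))) ⟩
      ∑ R (λ J → ∑ p (λ (c , K) → c * 𝟙 (K ≟ᴹ J) * φ J))
        ≡⟨ ∑-swap R p (λ J (c , K) → c * 𝟙 (K ≟ᴹ J) * φ J) ⟩
      ∑ p (λ (c , K) → ∑ R (λ J → c * 𝟙 (K ≟ᴹ J) * φ J))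
        ≡⟨ ∑-cong-∈ p (λ {(c , K)} m∈ → ≡.trans
             (≡.trans (∑-cong R (λ J → ℤ.*-assoc c (𝟙 (K ≟ᴹ J)) (φ J))) (∑-*ˡ R c (λ J → 𝟙 (K ≟ᴹ J) * φ J)))
             (cong (c *_) (∑-𝟙≟ _≟ᴹ_ (UniqueDec.deduplicate-! _≟ᴹ_ (map proj₂ p)) (∈-deduplicate⁺ _≟ᴹ_ (∈-map⁺ proj₂ m∈)) φ))) ⟩
      ev p φ ∎)
      where
      open ≡-Reasoning
      R = support p

    -- By `ev-support` this is the sum of the squares of all coefficients. In this form it arises
    -- directly when the square of a polynomial is evaluated.
    norm² : Poly m → ℤ
    norm² p = ev p (λ J → coeff J p)

    -- If the sum of squares is 0, then every coefficient is 0, and so is every functional at `p`.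
    -- One nonzero value is therefore enough.
    norm²≢0 : ∀ (p : Poly m) φ → ev p φ ≢ 0ℤ → norm² p ≢ 0ℤ
    norm²≢0 p φ h e = h (≡.trans (ev-support p φ) (∑-zero-∈ (support p) (λ {J} J∈ →
      cong (_* φ J) (∑-squares (λ J → coeff J p) (support p) (≡.trans (sym (ev-support p (λ J → coeff J p))) e) J∈))))

    evalᴹ : ∀ {m} → (Fin m → ℤ) → Monomial m → ℤ
    evalᴹ v []      = 1ℤ
    evalᴹ v (k ∷ K) = v zero ^ k * evalᴹ (v ∘ suc) K

    evalᴹ-𝟎 : ∀ {m} (v : Fin m → ℤ) → evalᴹ v 𝟎 ≡ 1ℤ
    evalᴹ-𝟎 {zero}  v = ≡.refl
    evalᴹ-𝟎 {suc m} v = ≡.trans (ℤ.*-identityˡ _) (evalᴹ-𝟎 (v ∘ suc))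

    evalᴹ-ε : ∀ {m} (v : Fin m → ℤ) t K → evalᴹ v (ε t ⊕ K) ≡ v t * evalᴹ v K
    evalᴹ-ε v zero    (k ∷ K) = ≡.trans (cong (λ J → v zero * v zero ^ k * evalᴹ (v ∘ suc) J) (⊕-identityˡ K))
      (ℤ.*-assoc (v zero) (v zero ^ k) _)
    evalᴹ-ε v (suc t) (k ∷ K) = ≡.trans (cong (v zero ^ k *_) (evalᴹ-ε (v ∘ suc) t K)) (*-leftComm (v zero ^ k) (v (suc t)) _)

    difference : Fin m × Fin m → LinForm m
    difference (a , b) = (1ℤ , a) ∷ (-1ℤ , b) ∷ []

    differences : List (Fin m × Fin m) → List (LinForm m)
    differences = map difference

    ev-difference : ∀ a b L φ → ev (prod (difference (a , b) ∷ L)) φ ≡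
                    ev (prod L) (λ K → φ (ε a ⊕ K)) - ev (prod L) (λ K → φ (ε b ⊕ K))
    ev-difference a b L φ = ≡.trans (ev-∷ (difference (a , b)) L φ)
      (lemma (ev (prod L) (λ K → φ (ε a ⊕ K))) (ev (prod L) (λ K → φ (ε b ⊕ K))))
      where
      lemma : ∀ x y → 1ℤ * x + (-1ℤ * y + 0ℤ) ≡ x - y
      lemma = solve-∀

    ev-differences-evalᴹ : ∀ (v : Fin m → ℤ) fs →
      ev (prod (differences fs)) (evalᴹ v) ≡ ∏ (map (λ (a , b) → v a - v b) fs)
    ev-differences-evalᴹ v []             = ≡.trans (ev-[] {m} (evalᴹ v)) (evalᴹ-𝟎 v)
    ev-differences-evalᴹ v ((a , b) ∷ fs) = begin
      ev (prod (differences ((a , b) ∷ fs))) (evalᴹ v)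
        ≡⟨ ev-difference a b (differences fs) (evalᴹ v) ⟩
      ev A (λ K → evalᴹ v (ε a ⊕ K)) - ev A (λ K → evalᴹ v (ε b ⊕ K))
        ≡⟨ cong₂ _-_ (one a) (one b) ⟩
      v a * X - v b * X
        ≡⟨ lemma (v a) (v b) X ⟩
      (v a - v b) * X
        ≡⟨ cong ((v a - v b) *_) (ev-differences-evalᴹ v fs) ⟩
      (v a - v b) * ∏ (map (λ (a , b) → v a - v b) fs) ∎
      where
      open ≡-Reasoning
      A = prod (differences fs)
      X = ev A (evalᴹ v)
      one : ∀ t → ev A (λ K → evalᴹ v (ε t ⊕ K)) ≡ v t * X
      one t = ≡.trans (ev-cong A (evalᴹ-ε v t)) (ev-*ˡ A (v t) (evalᴹ v))
      lemma : ∀ x y z → x * z - y * z ≡ (x - y) * z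
      lemma = solve-∀

    -- The exponent of the product of all `yₐ y_b`, about which the Newton polytope of the square of
    -- ∏ (yₐ - y_b) is symmetric.
    center : List (Fin m × Fin m) → Monomial m
    center fs = count (map proj₁ fs) ⊕ count (map proj₂ fs)

    center-∷ : ∀ a b fs → center ((a , b) ∷ fs) ≡ ε a ⊕ (ε b ⊕ center fs)
    center-∷ a b fs = ≡.trans (⊕-assoc (ε a) _ _) (cong (ε a ⊕_) (⊕-leftComm (count (map proj₁ fs)) (ε b) _))

    -- Exchanging the two ends of every difference shows that the coefficients of
    -- ∏ (yₐ − y_b) are, up to a global sign, symmetric about center / 2.
    ev-reflect : ∀ fs J D → ev (prod (differences fs)) (λ K → 𝟙 (J ⊕ K ≟ᴹ D ⊕ center fs)) ≡
                 ∏ (map (λ _ → -1ℤ) fs) * ev (prod (differences fs)) (λ K → 𝟙 (D ⊕ K ≟ᴹ J))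
    ev-reflect [] J D = begin
      ev (prod []) (λ K → 𝟙 (J ⊕ K ≟ᴹ D ⊕ center []))
        ≡⟨ ev-[] (λ K → 𝟙 (J ⊕ K ≟ᴹ D ⊕ center [])) ⟩
      𝟙 (J ⊕ 𝟎 ≟ᴹ D ⊕ center [])
        ≡⟨ 𝟙-⇔ (J ⊕ 𝟎 ≟ᴹ D ⊕ center []) (D ⊕ 𝟎 ≟ᴹ J)
             (λ e → ≡.trans (cong (D ⊕_) (sym (⊕-identityˡ 𝟎))) (≡.trans (sym e) (⊕-identityʳ J)))
             (λ e → ≡.trans (⊕-identityʳ J) (≡.trans (sym e) (cong (D ⊕_) (sym (⊕-identityˡ 𝟎))))) ⟩
      𝟙 (D ⊕ 𝟎 ≟ᴹ J)
        ≡⟨ ev-[] (λ K → 𝟙 (D ⊕ K ≟ᴹ J)) ⟨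
      ev (prod []) (λ K → 𝟙 (D ⊕ K ≟ᴹ J))
        ≡⟨ ℤ.*-identityˡ _ ⟨
      1ℤ * ev (prod []) (λ K → 𝟙 (D ⊕ K ≟ᴹ J)) ∎
      where open ≡-Reasoning
    ev-reflect ((a , b) ∷ fs) J D = begin
      ev (prod (differences ((a , b) ∷ fs))) (λ K → 𝟙 (J ⊕ K ≟ᴹ D ⊕ center ((a , b) ∷ fs)))
        ≡⟨ ev-difference a b (differences fs) (λ K → 𝟙 (J ⊕ K ≟ᴹ D ⊕ center ((a , b) ∷ fs))) ⟩
      ev A (λ K → 𝟙 (J ⊕ (ε a ⊕ K) ≟ᴹ D ⊕ center ((a , b) ∷ fs))) -
      ev A (λ K → 𝟙 (J ⊕ (ε b ⊕ K) ≟ᴹ D ⊕ center ((a , b) ∷ fs)))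
        ≡⟨ cong₂ _-_ (one a b (center-∷ a b fs)) (one b a (≡.trans (center-∷ a b fs) (⊕-leftComm (ε a) (ε b) (center fs)))) ⟩
      σ * Y b - σ * Y a
        ≡⟨ lemma σ (Y a) (Y b) ⟩
      -1ℤ * σ * (Y a - Y b)
        ≡⟨ cong (-1ℤ * σ *_) (ev-difference a b (differences fs) (λ K → 𝟙 (D ⊕ K ≟ᴹ J))) ⟨
      -1ℤ * σ * ev (prod (differences ((a , b) ∷ fs))) (λ K → 𝟙 (D ⊕ K ≟ᴹ J)) ∎
      where
      open ≡-Reasoning
      A = prod (differences fs)
      σ = ∏ (map (λ _ → -1ℤ) fs)
      Y : Fin m → ℤ
      Y t = ev A (λ K → 𝟙 (D ⊕ (ε t ⊕ K) ≟ᴹ J))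
      lemma : ∀ s x y → s * y - s * x ≡ -1ℤ * s * (x - y)
      lemma = solve-∀
      -- Choosing `a` from the factor cancels one end of the pair in the centre and moves the other
      -- end `b` to `D`, where it acts as the choice of `b` in the reflected product.
      one : ∀ a b {C} → C ≡ ε a ⊕ (ε b ⊕ center fs) → ev A (λ K → 𝟙 (J ⊕ (ε a ⊕ K) ≟ᴹ D ⊕ C)) ≡ σ * Y b
      one a b {C} eC = ≡.trans (ev-cong A (λ K → 𝟙-⇔ (J ⊕ (ε a ⊕ K) ≟ᴹ D ⊕ C) (J ⊕ K ≟ᴹ D ⊕ ε b ⊕ center fs)
          (λ e → ⊕-cancelˡ (ε a) (≡.trans (⊕-leftComm (ε a) J K) (≡.trans e (shuffle eC))))
          (λ e → ≡.trans (⊕-leftComm J (ε a) K) (≡.trans (cong (ε a ⊕_) e) (sym (shuffle eC))))))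
        (≡.trans (ev-reflect fs J (D ⊕ ε b)) (cong (σ *_) (ev-cong A (λ K → cong (λ z → 𝟙 (z ≟ᴹ J)) (⊕-assoc D (ε b) K)))))
        where
        shuffle : C ≡ ε a ⊕ (ε b ⊕ center fs) → D ⊕ C ≡ ε a ⊕ (D ⊕ ε b ⊕ center fs)
        shuffle e = ≡.trans (cong (D ⊕_) e) (≡.trans (⊕-leftComm D (ε a) _) (cong (ε a ⊕_) (sym (⊕-assoc D (ε b) _))))

    double : Fin m → LinForm m
    double w = (pos 2 , w) ∷ []

    ev-doubles : ∀ ws L φ → ev (prod (map double ws ++ L)) φ ≡
                 ∏ (map (λ _ → pos 2) ws) * ev (prod L) (λ K → φ (count ws ⊕ K))
    ev-doubles []       L φ = sym (≡.trans (ℤ.*-identityˡ _) (ev-cong (prod L) (λ K → cong φ (⊕-identityˡ K))))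
    ev-doubles (w ∷ ws) L φ = begin
      ev (prod (double w ∷ map double ws ++ L)) φ
        ≡⟨ ev-∷ (double w) (map double ws ++ L) φ ⟩
      pos 2 * ev (prod (map double ws ++ L)) (λ K → φ (ε w ⊕ K)) + 0ℤ
        ≡⟨ ℤ.+-identityʳ _ ⟩
      pos 2 * ev (prod (map double ws ++ L)) (λ K → φ (ε w ⊕ K))
        ≡⟨ cong (pos 2 *_) (ev-doubles ws L (λ K → φ (ε w ⊕ K))) ⟩
      pos 2 * (∏ (map (λ _ → pos 2) ws) * ev (prod L) (λ K → φ (ε w ⊕ (count ws ⊕ K))))
        ≡⟨ ℤ.*-assoc (pos 2) (∏ (map (λ _ → pos 2) ws)) (ev (prod L) (λ K → φ (ε w ⊕ (count ws ⊕ K)))) ⟨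
      pos 2 * ∏ (map (λ _ → pos 2) ws) * ev (prod L) (λ K → φ (ε w ⊕ (count ws ⊕ K)))
        ≡⟨ cong (pos 2 * ∏ (map (λ _ → pos 2) ws) *_) (ev-cong (prod L) (λ K → cong φ (⊕-assoc (ε w) (count ws) K))) ⟨
      pos 2 * ∏ (map (λ _ → pos 2) ws) * ev (prod L) (λ K → φ (count (w ∷ ws) ⊕ K)) ∎
      where open ≡-Reasoning

    -- The coefficient of the square of ∏ (yₐ − y_b) at its central monomial is,
    -- by the symmetry above, plus or minus the sum of the squares of all
    -- coefficients of ∏ (yₐ − y_b).
    center-coeff≢0 : ∀ ws fs → All (λ (a , b) → a ≢ b) fs →
      coeff (count ws ⊕ center fs) (prod (map double ws ++ differences fs ++ differences fs)) ≢ 0ℤ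
    center-coeff≢0 ws fs distinct e =
      *-≢0 {∏ (map (λ _ → pos 2) ws)} (∏≢0 (λ _ → pos 2) (λ _ ()) ws)
        (*-≢0 {σ} (∏≢0 (λ _ → -1ℤ) (λ _ ()) fs) (norm²≢0 A (evalᴹ v) nonzero))
        (≡.trans (sym value) e)
      where
      open ≡-Reasoning
      L = differences fs
      A = prod L
      σ = ∏ (map (λ _ → -1ℤ) fs)
      γ = count ws ⊕ center fs
      -- At a point with pairwise distinct coordinates no difference vanishes, which shows that `A`
      -- is not the zero polynomial.
      v : Fin m → ℤ
      v a = pos (toℕ a)
      nonzero : ev A (evalᴹ v) ≢ 0ℤ
      nonzero = subst (_≢ 0ℤ) (sym (ev-differences-evalᴹ v fs)) (go fs distinct)
        where
        go : ∀ fs → All (λ (a , b) → a ≢ b) fs → ∏ (map (λ (a , b) → v a - v b) fs) ≢ 0ℤ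
        go []             []      = λ ()
        go ((a , b) ∷ fs) (d ∷ ds) = *-≢0 {v a - v b} (λ z → d (toℕ-injective (ℤ.+-injective (ℤ.i-j≡0⇒i≡j (v a) (v b) z)))) (go fs ds)
      value : coeff γ (prod (map double ws ++ L ++ L)) ≡ ∏ (map (λ _ → pos 2) ws) * (σ * norm² A)
      value = begin
        coeff γ (prod (map double ws ++ L ++ L))
          ≡⟨ coeff-ev γ (prod (map double ws ++ L ++ L)) ⟩
        ev (prod (map double ws ++ L ++ L)) (λ J → 𝟙 (J ≟ᴹ γ))
          ≡⟨ ev-doubles ws (L ++ L) (λ J → 𝟙 (J ≟ᴹ γ)) ⟩
        τ * ev (prod (L ++ L)) (λ J → 𝟙 (count ws ⊕ J ≟ᴹ γ))
          ≡⟨ cong (τ *_) (ev-cong (prod (L ++ L)) (λ J → 𝟙-⇔ (count ws ⊕ J ≟ᴹ γ) (J ≟ᴹ 𝟎 ⊕ center fs)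
               (λ e → ≡.trans (⊕-cancelˡ (count ws) e) (sym (⊕-identityˡ _)))
               (λ e → cong (count ws ⊕_) (≡.trans e (⊕-identityˡ _))))) ⟩
        τ * ev (prod (L ++ L)) (λ J → 𝟙 (J ≟ᴹ 𝟎 ⊕ center fs))
          ≡⟨ cong (τ *_) (ev-++ L L (λ J → 𝟙 (J ≟ᴹ 𝟎 ⊕ center fs))) ⟩
        τ * ev A (λ J → ev A (λ K → 𝟙 (J ⊕ K ≟ᴹ 𝟎 ⊕ center fs)))
          ≡⟨ cong (τ *_) (ev-cong A (λ J → ≡.trans (ev-reflect fs J 𝟎) (cong (σ *_)
               (≡.trans (ev-cong A (λ K → cong (λ z → 𝟙 (z ≟ᴹ J)) (⊕-identityˡ K))) (sym (coeff-ev J A)))))) ⟩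
        τ * ev A (λ J → σ * coeff J A)
          ≡⟨ cong (τ *_) (ev-*ˡ A σ (λ J → coeff J A)) ⟩
        τ * (σ * norm² A) ∎
        where τ = ∏ (map (λ _ → pos 2) ws)

-- Counting elements and modifying vertex sets

open ℕ∑ using (∑; 𝟙)

length-∑ : {A : Set} (xs : List A) → length xs ≡ ∑ xs (λ _ → 1)
length-∑ []       = ≡.refl
length-∑ (x ∷ xs) = cong suc (length-∑ xs)

∑-allFin-𝟙 : ∀ {m} (a : Fin m) (f : Fin m → ℕ) → ∑ (allFin m) (λ x → 𝟙 (a ≟ x) ℕ.* f x) ≡ f a
∑-allFin-𝟙 {m} a f = ℕ∑.∑-𝟙≟ _≟_ (allFin⁺ m) (∈-allFin a) f

∑-mono-∈ : {A : Set} (xs : List A) {f g : A → ℕ} → (∀ {x} → x ∈ xs → f x ℕ.≤ g x) → ∑ xs f ℕ.≤ ∑ xs g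
∑-mono-∈ []       h = ℕ.z≤n
∑-mono-∈ (x ∷ xs) h = ℕ.+-mono-≤ (h (here ≡.refl)) (∑-mono-∈ xs (h ∘ there))

length-filter-unique : ∀ {m} {P : Fin m → Set} (P? : ∀ x → Dec (P x)) a → P a → (∀ x → P x → x ≡ a) →
                       length (filter P? (allFin m)) ≡ 1
length-filter-unique {m} P? a Pa unique = begin
  length (filter P? (allFin m))              ≡⟨ length-∑ (filter P? (allFin m)) ⟩
  ∑ (filter P? (allFin m)) (λ _ → 1)         ≡⟨ ℕ∑.∑-filter P? (allFin m) (λ _ → 1) ⟩
  ∑ (allFin m) (λ x → 𝟙 (P? x) ℕ.* 1)        ≡⟨ ℕ∑.∑-cong (allFin m) (λ x → cong (ℕ._* 1)
    (ℕ∑.𝟙-⇔ (P? x) (a ≟ x) (λ Px → sym (unique x Px)) (λ { ≡.refl → Pa }))) ⟩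
  ∑ (allFin m) (λ x → 𝟙 (a ≟ x) ℕ.* 1)       ≡⟨ ∑-allFin-𝟙 a (λ _ → 1) ⟩
  1                                          ∎
  where open ≡-Reasoning

∈-singleton : {A : Set} {xs : List A} {x y : A} → length xs ≡ 1 → x ∈ xs → y ∈ xs → x ≡ y
∈-singleton {xs = _ ∷ []} ≡.refl (here ≡.refl) (here ≡.refl) = ≡.refl

_[_↦_] : ∀ {n} → (Fin n → Bool) → Fin n → Bool → (Fin n → Bool)
(T [ u ↦ b ]) v = if does (v ≟ u) then b else T v

update-same : ∀ {n} (T : Fin n → Bool) u b → (T [ u ↦ b ]) u ≡ b
update-same T u b with u ≟ u
... | yes _  = ≡.refl
... | no u≢u = ⊥-elim (u≢u ≡.refl)

update-other : ∀ {n} (T : Fin n → Bool) {u v} b → v ≢ u → (T [ u ↦ b ]) v ≡ T v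
update-other T {u} {v} b v≢u with v ≟ u
... | yes e = ⊥-elim (v≢u e)
... | no  _ = ≡.refl

true≢false : true ≢ false
true≢false ()

-- Independent sets of maximum weight

module Independence {n : ℕ} (G : Graph n) where
  open Graph G

  lower≢upper : ∀ e → lower e ≢ upper e
  lower≢upper e eq = <-irrefl eq (ends-ordered e)

  Independent : (Fin n → Bool) → Set
  Independent T = ∀ e → T (lower e) ≡ true → T (upper e) ≡ true → ⊥

  Joins : Edge → Fin n → Fin n → Set
  Joins g u v = (lower g ≡ u × upper g ≡ v) ⊎ (lower g ≡ v × upper g ≡ u)

  joins? : ∀ g u v → Dec (Joins g u v)
  joins? g u v = ((lower g ≟ u) ×-dec (upper g ≟ v)) ⊎-dec ((lower g ≟ v) ×-dec (upper g ≟ u))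

  -- Every edge is directed from bot to top along the order in which the
  -- vertices outside T come first, in their natural order.
  module Split (T : Fin n → Bool) where

    top bot : Edge → Fin n
    top e = if T (lower e) then lower e else upper e
    bot e = if T (lower e) then upper e else lower e

    leaves? : ∀ z e → Dec (bot e ≡ z × T (top e) ≡ true)
    leaves? z e = (bot e ≟ z) ×-dec (T (top e) Bool.≟ true)

    T-edges : Fin n → List Edge
    T-edges z = filter (leaves? z) (allFin ∣E∣)

    -- For an independent `T` and `z` outside it, this is the number of neighbours of `z` in `T`.
    -- The value 1 means that `z` is a private neighbour.
    t : Fin n → ℕ
    t z = length (T-edges z)

    joins-bot-top : ∀ e → Joins e (bot e) (top e)
    joins-bot-top e with T (lower e)
    ... | true  = inj₂ (≡.refl , ≡.refl)
    ... | false = inj₁ (≡.refl , ≡.refl)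

    bot≢top : ∀ e → bot e ≢ top e
    bot≢top e with T (lower e)
    ... | true  = lower≢upper e ∘ sym
    ... | false = lower≢upper e

    -- In the two mixed cases the edges would join the same two vertices with the lower and the
    -- upper end exchanged, contrary to `ends-ordered`.
    edge-unique : ∀ {e e′} → bot e ≡ bot e′ → top e ≡ top e′ → e ≡ e′
    edge-unique {e} {e′} eb et with T (lower e) | T (lower e′)
    ... | true  | true  = ends-injective (cong₂ _,_ et eb)
    ... | false | false = ends-injective (cong₂ _,_ eb et)
    ... | true  | false = ⊥-elim (ℕ.<-asym (ends-ordered e) (≡.subst₂ Fin._<_ (sym eb) (sym et) (ends-ordered e′)))
    ... | false | true  = ⊥-elim (ℕ.<-asym (ends-ordered e) (≡.subst₂ Fin._<_ (sym et) (sym eb) (ends-ordered e′)))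

    ∈-T-edges : ∀ {z e} → bot e ≡ z → T (top e) ≡ true → e ∈ T-edges z
    ∈-T-edges {z} {e} b tt = ∈-filter⁺ (leaves? z) (∈-allFin e) (b , tt)

    T-edge-unique : ∀ {e e′} → T (top e) ≡ true → t (bot e) ≡ 1 → bot e′ ≡ bot e → T (top e′) ≡ true → e′ ≡ e
    T-edge-unique tt one b tt′ = ∈-singleton one (∈-T-edges b tt′) (∈-T-edges ≡.refl tt)

    bot-lower : ∀ {e} → T (lower e) ≡ false → bot e ≡ lower e × top e ≡ upper e
    bot-lower {e} h rewrite h = ≡.refl , ≡.refl

    bot-upper : ∀ {e} → T (lower e) ≡ true → bot e ≡ upper e × top e ≡ lower e
    bot-upper {e} h rewrite h = ≡.refl , ≡.refl

    bot∉T : Independent T → ∀ e → T (bot e) ≡ false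
    bot∉T ind e with T (lower e) in eq
    ... | true  = ¬-not (ind e eq)
    ... | false = eq

    top-incident : Independent T → ∀ {w e} → T w ≡ true → Incident w e → top e ≡ w
    top-incident ind Tw (inj₁ ≡.refl) = proj₂ (bot-upper Tw)
    top-incident ind {e = e} Tw (inj₂ ≡.refl) = proj₂ (bot-lower (¬-not (λ h → ind e h Tw)))

  -- The consequences of maximum weight on which the construction rests. They are decidable local
  -- conditions, so they can be reached by successive improvements without comparing all independent
  -- sets.
  record Good (T : Fin n → Bool) : Set where
    open Split T
    field
      independent : Independent T
      dominating  : ∀ u → T u ≡ false → ∃[ e ] bot e ≡ u × T (top e) ≡ true
      clique      : ∀ e e′ → e ≢ e′ → top e ≡ top e′ → T (top e) ≡ true → t (bot e) ≡ 1 → t (bot e′) ≡ 1 →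
                    ∃[ g ] Joins g (bot e) (bot e′)
      another     : ∀ e → T (top e) ≡ true → t (bot e) ≡ 1 → ∃[ e′ ] e′ ≢ e × top e′ ≡ top e

  -- Exchanging a leaf for a vertex that is not a leaf is a gain, and any two vertices still
  -- outweigh a single one because 2 + 2 > 3.
  weight : Fin n → ℕ
  weight v = if does (degree v ℕ.≟ 1) then 2 else 3

  2≤weight : ∀ v → 2 ℕ.≤ weight v
  2≤weight v with does (degree v ℕ.≟ 1)
  ... | true  = ℕ.≤-refl
  ... | false = ℕ.n≤1+n 2

  weight≤3 : ∀ v → weight v ℕ.≤ 3
  weight≤3 v with does (degree v ℕ.≟ 1)
  ... | true  = ℕ.n≤1+n 2
  ... | false = ℕ.≤-refl

  restrict : Bool → ℕ → ℕ
  restrict b k = if b then k else 0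

  total : (Fin n → Bool) → ℕ
  total T = ∑ (allFin n) (λ v → restrict (T v) (weight v))

  total-update : ∀ T u b → total (T [ u ↦ b ]) ℕ.+ restrict (T u) (weight u) ≡ total T ℕ.+ restrict b (weight u)
  total-update T u b = begin
    ∑ V (f′) ℕ.+ restrict (T u) (weight u)
      ≡⟨ cong (∑ V f′ ℕ.+_) (∑-allFin-𝟙 u (λ v → restrict (T v) (weight v))) ⟨
    ∑ V f′ ℕ.+ ∑ V (λ v → 𝟙 (u ≟ v) ℕ.* restrict (T v) (weight v))
      ≡⟨ ℕ∑.∑-+ V f′ _ ⟨
    ∑ V (λ v → f′ v ℕ.+ 𝟙 (u ≟ v) ℕ.* restrict (T v) (weight v))
      ≡⟨ ℕ∑.∑-cong V pointwise ⟩
    ∑ V (λ v → restrict (T v) (weight v) ℕ.+ 𝟙 (u ≟ v) ℕ.* restrict b (weight v))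
      ≡⟨ ℕ∑.∑-+ V _ _ ⟩
    total T ℕ.+ ∑ V (λ v → 𝟙 (u ≟ v) ℕ.* restrict b (weight v))
      ≡⟨ cong (total T ℕ.+_) (∑-allFin-𝟙 u (λ v → restrict b (weight v))) ⟩
    total T ℕ.+ restrict b (weight u) ∎
    where
    open ≡-Reasoning
    V = allFin n
    f′ : Fin n → ℕ
    f′ v = restrict ((T [ u ↦ b ]) v) (weight v)
    pointwise : ∀ v → f′ v ℕ.+ 𝟙 (u ≟ v) ℕ.* restrict (T v) (weight v) ≡
                      restrict (T v) (weight v) ℕ.+ 𝟙 (u ≟ v) ℕ.* restrict b (weight v)
    pointwise v with v ≟ u
    ... | yes ≡.refl rewrite ℕ∑.𝟙-yes (u ≟ u) ≡.refl | ℕ.+-identityʳ (restrict (T u) (weight u)) | ℕ.+-identityʳ (restrict b (weight u)) =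
      ℕ.+-comm (restrict b (weight u)) _
    ... | no v≢u rewrite ℕ∑.𝟙-no (u ≟ v) (v≢u ∘ sym) = ≡.refl

  total-add : ∀ T u → T u ≡ false → total (T [ u ↦ true ]) ≡ total T ℕ.+ weight u
  total-add T u h = ≡.trans (sym (ℕ.+-identityʳ _))
    (≡.trans (cong (λ b → total (T [ u ↦ true ]) ℕ.+ restrict b (weight u)) (sym h)) (total-update T u true))

  total-remove : ∀ T w → T w ≡ true → total (T [ w ↦ false ]) ℕ.+ weight w ≡ total T
  total-remove T w h = ≡.trans (cong (λ b → total (T [ w ↦ false ]) ℕ.+ restrict b (weight w)) (sym h))
    (≡.trans (total-update T w false) (ℕ.+-identityʳ _))

  total≤3n : ∀ T → total T ℕ.≤ ∑ (allFin n) (λ _ → 3)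
  total≤3n T = ∑-mono-∈ (allFin n) (λ {v} _ → bound (T v) v)
    where
    bound : ∀ b v → restrict b (weight v) ℕ.≤ 3
    bound true  v = weight≤3 v
    bound false v = ℕ.z≤n

  Free : (Fin n → Bool) → Fin n → Set
  Free T u = ∀ e → (lower e ≡ u → T (upper e) ≡ false) × (upper e ≡ u → T (lower e) ≡ false)

  independent-add : ∀ T u → Independent T → Free T u → Independent (T [ u ↦ true ])
  independent-add T u ind free e p q with lower e ≟ u | upper e ≟ u
  ... | yes l | yes r = lower≢upper e (≡.trans l (sym r))
  ... | yes l | no  _ = true≢false (≡.trans (sym q) (proj₁ (free e) l))
  ... | no  _ | yes r = true≢false (≡.trans (sym p) (proj₂ (free e) r))
  ... | no  _ | no  _ = ind e p q

  independent-remove : ∀ T w → Independent T → Independent (T [ w ↦ false ])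
  independent-remove T w ind e p q with lower e ≟ w | upper e ≟ w
  ... | no  _ | no  _ = ind e p q

  -- An edge from `u` into `T′` also ends in `T`. It is thus directed away from `u` in the splitting
  -- by `T`, where the last hypothesis applies.
  free : ∀ T T′ → (∀ v → T′ v ≡ true → T v ≡ true) → ∀ u → T u ≡ false → let open Split T in
         (∀ f → bot f ≡ u → T (top f) ≡ true → T′ (top f) ≡ false) → Free T′ u
  free T T′ sub u Tu h f = from-lower , from-upper
    where
    open Split T
    from-lower : lower f ≡ u → T′ (upper f) ≡ false
    from-lower ≡.refl with b , tp ← bot-lower {f} Tu = ¬-not λ r → true≢false (≡.trans (sym r)
      (subst (λ z → T′ z ≡ false) tp (h f b (subst (λ z → T z ≡ true) (sym tp) (sub _ r)))))
    from-upper : upper f ≡ u → T′ (lower f) ≡ false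
    from-upper ≡.refl = ¬-not λ r → let b , tp = bot-upper {f} (sub _ r) in true≢false (≡.trans (sym r)
      (subst (λ z → T′ z ≡ false) tp (h f b (subst (λ z → T z ≡ true) (sym tp) (sub _ r)))))

  module Improve (nice : Nice) (T : Fin n → Bool) (ind : Independent T) where
    open Split T

    Better : Set
    Better = ∃[ T′ ] Independent T′ × total T ℕ.< total T′

    add-free : ∀ u → T u ≡ false → (∀ e → ¬ (bot e ≡ u × T (top e) ≡ true)) → Better
    add-free u Tu none = T [ u ↦ true ] , independent-add T u ind (free T T (λ _ r → r) u Tu (λ f b r → ⊥-elim (none f (b , r)))) ,
      subst (total T ℕ.<_) (sym (total-add T u Tu)) (ℕ.m<m+n (total T) (ℕ.<-≤-trans ℕ.z<s (2≤weight u)))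

    module Swap (e : Edge) (Tw : T (top e) ≡ true) (one : t (bot e) ≡ 1) where
      w u : Fin n
      w = top e
      u = bot e
      T₁ = T [ w ↦ false ]

      sub : ∀ v → T₁ v ≡ true → T v ≡ true
      sub v h with v ≟ w
      ... | no _ = h

      T₁u : T₁ u ≡ false
      T₁u = ≡.trans (update-other T false (bot≢top e)) (bot∉T ind e)

      T₂ = T₁ [ u ↦ true ]

      -- The only neighbour of `u` in `T` is `w`, which has just been removed.
      ind₂ : Independent T₂
      ind₂ = independent-add T₁ u (independent-remove T w ind) (free T T₁ sub u (bot∉T ind e)
        (λ f b r → subst (λ g → T₁ (top g) ≡ false) (sym (T-edge-unique Tw one b r)) (update-same T w false)))

      total₂ : total T₂ ℕ.+ weight w ≡ total T ℕ.+ weight u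
      total₂ = begin
        total T₂ ℕ.+ weight w                ≡⟨ cong (ℕ._+ weight w) (total-add T₁ u T₁u) ⟩
        total T₁ ℕ.+ weight u ℕ.+ weight w   ≡⟨ ℕ.+-assoc (total T₁) _ _ ⟩
        total T₁ ℕ.+ (weight u ℕ.+ weight w) ≡⟨ cong (total T₁ ℕ.+_) (ℕ.+-comm (weight u) _) ⟩
        total T₁ ℕ.+ (weight w ℕ.+ weight u) ≡⟨ ℕ.+-assoc (total T₁) _ _ ⟨
        total T₁ ℕ.+ weight w ℕ.+ weight u   ≡⟨ cong (ℕ._+ weight u) (total-remove T w Tw) ⟩
        total T ℕ.+ weight u                 ∎
        where open ≡-Reasoning

    -- Two nonadjacent private neighbours of `w` can replace `w` together: at least 2 + 2 is gained
    -- and at most 3 is lost.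
    swap-pair : ∀ e e′ → e ≢ e′ → top e ≡ top e′ → T (top e) ≡ true → t (bot e) ≡ 1 → t (bot e′) ≡ 1 →
                (∀ g → ¬ Joins g (bot e) (bot e′)) → Better
    swap-pair e e′ e≢e′ et Tw one one′ apart = T₂ [ u′ ↦ true ] , independent-add T₂ u′ ind₂ free₂ , bigger
      where
      open Swap e Tw one
      u′ = bot e′
      Tw′ : T (top e′) ≡ true
      Tw′ = subst (λ z → T z ≡ true) et Tw
      u′≢u : u′ ≢ u
      u′≢u b = e≢e′ (sym (T-edge-unique Tw one b Tw′))
      free₁ : Free T₁ u′
      free₁ = free T T₁ sub u′ (bot∉T ind e′) (λ f b r → subst (λ z → T₁ z ≡ false)
        (≡.trans et (cong top (sym (T-edge-unique Tw′ one′ b r)))) (update-same T w false))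
      free₂ : Free T₂ u′
      free₂ f = (λ l → ≡.trans (update-other T₁ true (λ r → apart f (inj₂ (l , r)))) (proj₁ (free₁ f) l)) ,
                (λ r → ≡.trans (update-other T₁ true (λ l → apart f (inj₁ (l , r)))) (proj₂ (free₁ f) r))
      T₂u′ : T₂ u′ ≡ false
      T₂u′ = ≡.trans (update-other T₁ true u′≢u) (≡.trans (update-other T false (λ b → bot≢top e′ (≡.trans b et))) (bot∉T ind e′))
      bigger : total T ℕ.< total (T₂ [ u′ ↦ true ])
      bigger = ℕ.+-cancelʳ-≤ 3 _ _ (begin
        suc (total T) ℕ.+ 3              ≡⟨ ℕ.+-suc (total T) 3 ⟨
        total T ℕ.+ 4                    ≤⟨ ℕ.+-monoʳ-≤ (total T) (ℕ.+-mono-≤ (2≤weight u) (2≤weight u′)) ⟩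
        total T ℕ.+ (weight u ℕ.+ weight u′) ≡⟨ ℕ.+-assoc (total T) _ _ ⟨
        total T ℕ.+ weight u ℕ.+ weight u′   ≡⟨ cong (ℕ._+ weight u′) total₂ ⟨
        total T₂ ℕ.+ weight w ℕ.+ weight u′  ≡⟨ ℕ.+-assoc (total T₂) _ _ ⟩
        total T₂ ℕ.+ (weight w ℕ.+ weight u′) ≡⟨ cong (total T₂ ℕ.+_) (ℕ.+-comm (weight w) _) ⟩
        total T₂ ℕ.+ (weight u′ ℕ.+ weight w) ≡⟨ ℕ.+-assoc (total T₂) _ _ ⟨
        total T₂ ℕ.+ weight u′ ℕ.+ weight w   ≡⟨ cong (ℕ._+ weight w) (total-add T₂ u′ T₂u′) ⟨
        total (T₂ [ u′ ↦ true ]) ℕ.+ weight w ≤⟨ ℕ.+-monoʳ-≤ (total (T₂ [ u′ ↦ true ])) (weight≤3 w) ⟩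
        total (T₂ [ u′ ↦ true ]) ℕ.+ 3   ∎)
        where open ℕ.≤-Reasoning

    -- Here `e` is the only edge at `w`, so `w` is a leaf and, as `e` is not isolated, `u` is not.
    -- Exchanging them gains 3 and loses 2.
    swap-leaf : ∀ e → T (top e) ≡ true → t (bot e) ≡ 1 → (∀ e′ → ¬ (e′ ≢ e × top e′ ≡ top e)) → Better
    swap-leaf e Tw one alone = T₂ , ind₂ , ℕ.+-cancelʳ-≤ 2 _ _ (begin
        suc (total T) ℕ.+ 2    ≡⟨ ℕ.+-suc (total T) 2 ⟨
        total T ℕ.+ 3          ≡⟨ cong (total T ℕ.+_) weight-u ⟨
        total T ℕ.+ weight u   ≡⟨ total₂ ⟨
        total T₂ ℕ.+ weight w  ≡⟨ cong (total T₂ ℕ.+_) weight-w ⟩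
        total T₂ ℕ.+ 2         ∎)
      where
      open Swap e Tw one
      open ℕ.≤-Reasoning
      degree-w : degree w ≡ 1
      degree-w = length-filter-unique (incident? w) e (incident-top e)
        (λ f i → decidable-stable (f ≟ e) (λ f≢e → alone f (f≢e , top-incident ind Tw i)))
        where
        incident-top : ∀ e → Incident (top e) e
        incident-top e with T (lower e)
        ... | true  = inj₁ ≡.refl
        ... | false = inj₂ ≡.refl
      degree-u : degree u ≢ 1
      degree-u d with joins-bot-top e
      ... | inj₁ (l , r) = nice e (≡.trans (cong degree l) d , ≡.trans (cong degree r) degree-w)
      ... | inj₂ (l , r) = nice e (≡.trans (cong degree l) degree-w , ≡.trans (cong degree r) d)
      weight-w : weight w ≡ 2
      weight-w = cong (λ d → if does (d ℕ.≟ 1) then 2 else 3) degree-w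
      weight-u : weight u ≡ 3
      weight-u = not-one (degree u) degree-u
        where
        not-one : ∀ d → d ≢ 1 → (if does (d ℕ.≟ 1) then 2 else 3) ≡ 3
        not-one zero          h = ≡.refl
        not-one (suc zero)    h = ⊥-elim (h ≡.refl)
        not-one (suc (suc d)) h = ≡.refl

    -- A finite search either finds a violation of one of the conditions, which yields an
    -- improvement, or proves all of them.
    improve : Better ⊎ Good T
    improve
      with any? (λ u → (T u Bool.≟ false) ×-dec ¬? (any? (leaves? u)))
    ... | yes (u , Tu , none) = inj₁ (add-free u Tu (λ e h → none (e , h)))
    ... | no ¬dom
      with any? (λ e → any? (λ e′ → ¬? (e ≟ e′) ×-dec (top e ≟ top e′) ×-dec (T (top e) Bool.≟ true) ×-dec
                        (t (bot e) ℕ.≟ 1) ×-dec (t (bot e′) ℕ.≟ 1) ×-dec ¬? (any? (λ g → joins? g (bot e) (bot e′)))))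
    ... | yes (e , e′ , e≢e′ , et , Tw , one , one′ , none) =
      inj₁ (swap-pair e e′ e≢e′ et Tw one one′ (λ g j → none (g , j)))
    ... | no ¬clique
      with any? (λ e → (T (top e) Bool.≟ true) ×-dec (t (bot e) ℕ.≟ 1) ×-dec ¬? (any? (λ e′ → ¬? (e′ ≟ e) ×-dec (top e′ ≟ top e))))
    ... | yes (e , Tw , one , none) = inj₁ (swap-leaf e Tw one (λ e′ h → none (e′ , h)))
    ... | no ¬another = inj₂ (record
      { independent = ind
      ; dominating  = λ u Tu → decidable-stable (any? (leaves? u)) (λ none → ¬dom (u , Tu , none))
      ; clique      = λ e e′ e≢e′ et Tw one one′ → decidable-stable (any? (λ g → joins? g (bot e) (bot e′)))
                        (λ none → ¬clique (e , e′ , e≢e′ , et , Tw , one , one′ , none))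
      ; another     = λ e Tw one → decidable-stable (any? (λ e′ → ¬? (e′ ≟ e) ×-dec (top e′ ≟ top e)))
                        (λ none → ¬another (e , Tw , one , none))
      })

  -- The climb starts at the empty set and terminates because every improvement raises the total,
  -- which is at most 3n. The number `k` bounds the room that is left.
  good-set : Nice → ∃[ T ] Good T
  good-set nice = climb (∑ (allFin n) (λ _ → 3)) (λ _ → false) (λ _ ()) (ℕ.m≤n+m _ _)
    where
    climb : ∀ k T → Independent T → ∑ (allFin n) (λ _ → 3) ℕ.≤ total T ℕ.+ k → ∃[ T ] Good T
    climb k T ind h with Improve.improve nice T ind
    ... | inj₂ good = T , good
    -- With no room left the total of `T` already attains the bound, so a larger total is
    -- impossible.
    climb zero    T ind h | inj₁ (T′ , ind′ , lt) =
      ⊥-elim (ℕ.<-irrefl ≡.refl (ℕ.<-≤-trans lt (ℕ.≤-trans (total≤3n T′) (subst (_ ℕ.≤_) (ℕ.+-identityʳ _) h))))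
    climb (suc k) T ind h | inj₁ (T′ , ind′ , lt) =
      climb k T′ ind′ (ℕ.≤-trans h (ℕ.≤-trans (ℕ.≤-reflexive (ℕ.+-suc (total T) k)) (ℕ.+-monoˡ-≤ k lt)))

-- Cycles and counting

close : {A : Set} → A → A → List A → List (A × A)
close f x []       = (x , f) ∷ []
close f x (y ∷ ys) = (x , y) ∷ close f y ys

cyclic : {A : Set} → List A → List (A × A)
cyclic []       = []
cyclic (x ∷ xs) = close x x xs

∑-cyclic₁ : {A : Set} (xs : List A) (φ : A → ℕ) → ∑ (cyclic xs) (φ ∘ proj₁) ≡ ∑ xs φ
∑-cyclic₁ []       φ = ≡.refl
∑-cyclic₁ (x ∷ xs) φ = go x xs
  where
  go : ∀ y ys → ∑ (close x y ys) (φ ∘ proj₁) ≡ ∑ (y ∷ ys) φ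
  go y []       = ≡.refl
  go y (z ∷ zs) = cong (φ y ℕ.+_) (go z zs)

∑-cyclic₂ : {A : Set} (xs : List A) (φ : A → ℕ) → ∑ (cyclic xs) (φ ∘ proj₂) ≡ ∑ xs φ
∑-cyclic₂ []       φ = ≡.refl
∑-cyclic₂ (x ∷ xs) φ = ≡.trans (go x xs) (ℕ.+-comm (∑ xs φ) (φ x))
  where
  go : ∀ y ys → ∑ (close x y ys) (φ ∘ proj₂) ≡ ∑ ys φ ℕ.+ φ x
  go y []       = ℕ.+-identityʳ (φ x)
  go y (z ∷ zs) = ≡.trans (cong (φ z ℕ.+_) (go z zs)) (sym (ℕ.+-assoc (φ z) _ _))

cyclic-All : {A : Set} {R : A → Set} {xs : List A} → All R xs → All (λ (x , y) → R x × R y) (cyclic xs)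
cyclic-All []               = []
cyclic-All {A} {R} {x ∷ xs} (r ∷ rs) = go r rs
  where
  go : ∀ {y ys} → R y → All R ys → All (λ (x , y) → R x × R y) (close x y ys)
  go ry []        = (ry , r) ∷ []
  go ry (rz ∷ rs) = (ry , rz) ∷ go rz rs

-- A one-element list would be paired with itself; the second hypothesis excludes this. In a longer
-- list, neighbours differ by uniqueness, and so do the last and the first element.
cyclic-≢ : {A : Set} {xs : List A} → Unique xs → (∀ {x} → x ∈ xs → ∃[ y ] y ∈ xs × y ≢ x) →
           All (λ (x , y) → x ≢ y) (cyclic xs)
cyclic-≢ []          h = []
cyclic-≢ ([] ∷ _)    h with h (here ≡.refl)
... | _ , here ≡.refl , y≢x = ⊥-elim (y≢x ≡.refl)
cyclic-≢ {xs = x ∷ y ∷ ys} ((x≢y ∷ x≢ys) ∷ u) h = x≢y ∷ go (x≢y ∷ x≢ys) u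
  where
  go : ∀ {y ys} → All (x ≢_) (y ∷ ys) → Unique (y ∷ ys) → All (λ (x , y) → x ≢ y) (close x y ys)
  go {ys = []}    (x≢y ∷ _)    _                 = (x≢y ∘ sym) ∷ []
  go {ys = _ ∷ _} (_ ∷ x≢zs)   ((y≢z ∷ _) ∷ u)   = y≢z ∷ go x≢zs u

𝟙-× : {P Q : Set} (d : Dec P) (d′ : Dec Q) → 𝟙 d ℕ.* 𝟙 d′ ≡ 𝟙 (d ×-dec d′)
𝟙-× (yes _) (yes _) = ≡.refl
𝟙-× (yes _) (no _)  = ≡.refl
𝟙-× (no _)  d′      = ≡.refl

𝟙-mono : {P Q : Set} (d : Dec P) (d′ : Dec Q) → (P → Q) → 𝟙 d ℕ.≤ 𝟙 d′
𝟙-mono (yes p) d′ f = ℕ.≤-reflexive (sym (ℕ∑.𝟙-yes d′ (f p)))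
𝟙-mono (no _)  d′ f = ℕ.z≤n

∑-at-most-one : ∀ {m} {P : Fin m → Set} (P? : ∀ x → Dec (P x)) → (∀ {x y} → P x → P y → x ≡ y) →
                ∑ (allFin m) (λ x → 𝟙 (P? x)) ℕ.≤ 1
∑-at-most-one {m} P? unique with any? P?
... | no none = ℕ.≤-trans (ℕ.≤-reflexive (ℕ∑.∑-zero-∈ (allFin m) (λ {x} _ → ℕ∑.𝟙-no (P? x) (λ p → none (x , p))))) ℕ.z≤n
... | yes (a , p) = ℕ.≤-trans
  (∑-mono-∈ (allFin m) (λ {x} _ → ℕ.≤-trans (𝟙-mono (P? x) (a ≟ x) (unique p)) (ℕ.≤-reflexive (sym (ℕ.*-identityʳ _)))))
  (ℕ.≤-reflexive (∑-allFin-𝟙 a (λ _ → 1)))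

term≤∑ : {A : Set} {xs : List A} {x : A} (f : A → ℕ) → x ∈ xs → f x ℕ.≤ ∑ xs f
term≤∑ f (here ≡.refl)     = ℕ.m≤m+n _ _
term≤∑ f (there {x = y} m) = ℕ.≤-trans (term≤∑ f m) (ℕ.m≤n+m _ (f y))

∑-𝟙-≟ : ∀ {m} {P : Fin m → Set} (P? : ∀ x → Dec (P x)) (s : Fin m) →
        ∑ (allFin m) (λ x → 𝟙 (P? x) ℕ.* 𝟙 (s ≟ x)) ≡ 𝟙 (P? s)
∑-𝟙-≟ {m} P? s = ≡.trans (ℕ∑.∑-cong (allFin m) (λ x → ℕ.*-comm (𝟙 (P? x)) _)) (∑-allFin-𝟙 s (λ x → 𝟙 (P? x)))

monomial-ext : ∀ {m} {J K : Monomial m} → (∀ i → lookup J i ≡ lookup K i) → J ≡ K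
monomial-ext {J = J} {K} h = ≡.trans (sym (tabulate∘lookup J)) (≡.trans (tabulate-cong h) (tabulate∘lookup K))

count-complete : ∀ {m} (ts : List (Fin m)) (K : Monomial m) → (∀ i → occ i ts ℕ.≤ lookup K i) →
                 ∃[ ss ] count (ss ++ ts) ≡ K
count-complete {m} ts K h = ss , monomial-ext (λ i → begin
  lookup (count (ss ++ ts)) i                    ≡⟨ lookup-count i (ss ++ ts) ⟩
  occ i (ss ++ ts)                               ≡⟨ ℕ∑.∑-++ ss ts _ ⟩
  occ i ss ℕ.+ occ i ts                          ≡⟨ cong (ℕ._+ occ i ts) (occ-ss i) ⟩
  D i ℕ.+ occ i ts                               ≡⟨ ℕ.m∸n+n≡m (h i) ⟩
  lookup K i                                     ∎)
  where
  open ≡-Reasoning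
  D : Fin m → ℕ
  D i = lookup K i ℕ.∸ occ i ts
  -- Every `j` is listed as often as `K` exceeds its multiplicity in `ts`; these are the excess
  -- rows.
  ss = concatMap (λ j → replicate (D j) j) (allFin m)
  occ-replicate : ∀ i k j → occ i (replicate k j) ≡ 𝟙 (i ≟ j) ℕ.* k
  occ-replicate i zero    j = sym (ℕ.*-zeroʳ (𝟙 (i ≟ j)))
  occ-replicate i (suc k) j = ≡.trans (cong (𝟙 (i ≟ j) ℕ.+_) (occ-replicate i k j)) (sym (ℕ.*-suc (𝟙 (i ≟ j)) k))
  occ-ss : ∀ i → occ i ss ≡ D i
  occ-ss i = ≡.trans (ℕ∑.∑-concatMap (λ j → replicate (D j) j) (allFin m) (λ t → 𝟙 (i ≟ t)))
    (≡.trans (ℕ∑.∑-cong (allFin m) (λ j → occ-replicate i (D j) j)) (∑-allFin-𝟙 i D))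

-- For every value z of κ, the elements with P and κ = z, joined into a cycle.
module Cycles {m n : ℕ} (κ : Fin m → Fin n) {P : Fin m → Set} (P? : ∀ e → Dec (P e))
              (partner : ∀ e → P e → ∃[ e′ ] e′ ≢ e × κ e′ ≡ κ e × P e′) where

  fibre? : ∀ z e → Dec (P e × κ e ≡ z)
  fibre? z e = P? e ×-dec (κ e ≟ z)

  fibre : Fin n → List (Fin m)
  fibre z = filter (fibre? z) (allFin m)

  pairs : List (Fin m × Fin m)
  pairs = concatMap (cyclic ∘ fibre) (allFin n)

  ∑-fibres : ∀ φ → ∑ (allFin n) (λ z → ∑ (fibre z) φ) ≡ ∑ (allFin m) (λ e → 𝟙 (P? e) ℕ.* φ e)
  ∑-fibres φ = begin
    ∑ (allFin n) (λ z → ∑ (fibre z) φ)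
      ≡⟨ ℕ∑.∑-cong (allFin n) (λ z → ℕ∑.∑-filter (fibre? z) (allFin m) φ) ⟩
    ∑ (allFin n) (λ z → ∑ (allFin m) (λ e → 𝟙 (fibre? z e) ℕ.* φ e))
      ≡⟨ ℕ∑.∑-swap (allFin n) (allFin m) _ ⟩
    ∑ (allFin m) (λ e → ∑ (allFin n) (λ z → 𝟙 (fibre? z e) ℕ.* φ e))
      ≡⟨ ℕ∑.∑-cong (allFin m) (λ e → ≡.trans
           (ℕ∑.∑-cong (allFin n) (λ z → cong (ℕ._* φ e) (≡.trans (sym (𝟙-× (P? e) (κ e ≟ z))) (ℕ.*-comm (𝟙 (P? e)) _))))
           (≡.trans (ℕ∑.∑-cong (allFin n) (λ z → ℕ.*-assoc (𝟙 (κ e ≟ z)) (𝟙 (P? e)) (φ e)))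
             (∑-allFin-𝟙 (κ e) (λ _ → 𝟙 (P? e) ℕ.* φ e)))) ⟩
    ∑ (allFin m) (λ e → 𝟙 (P? e) ℕ.* φ e) ∎
    where open ≡-Reasoning

  -- In a cycle every element is a first component exactly once, and the fibres partition the
  -- elements with `P`.
  ∑-pairs₁ : ∀ φ → ∑ pairs (φ ∘ proj₁) ≡ ∑ (allFin m) (λ e → 𝟙 (P? e) ℕ.* φ e)
  ∑-pairs₁ φ = ≡.trans (ℕ∑.∑-concatMap (cyclic ∘ fibre) (allFin n) (φ ∘ proj₁))
    (≡.trans (ℕ∑.∑-cong (allFin n) (λ z → ∑-cyclic₁ (fibre z) φ)) (∑-fibres φ))

  ∑-pairs₂ : ∀ φ → ∑ pairs (φ ∘ proj₂) ≡ ∑ (allFin m) (λ e → 𝟙 (P? e) ℕ.* φ e)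
  ∑-pairs₂ φ = ≡.trans (ℕ∑.∑-concatMap (cyclic ∘ fibre) (allFin n) (φ ∘ proj₂))
    (≡.trans (ℕ∑.∑-cong (allFin n) (λ z → ∑-cyclic₂ (fibre z) φ)) (∑-fibres φ))

  pairs-All : All (λ (e , e′) → P e × P e′ × κ e ≡ κ e′ × e ≢ e′) pairs
  pairs-All = All.concat⁺ (All.map⁺ {xs = allFin n} (All.tabulate (λ {z} _ → All.zipWith
      (λ { (((p , k) , (p′ , k′)) , e≢e′) → p , p′ , ≡.trans k (sym k′) , e≢e′ })
      (cyclic-All (All.all-filter (fibre? z) (allFin m)) , cyclic-≢ (filter⁺ (fibre? z) (allFin⁺ m)) (other z)))))
    where
    other : ∀ z {e} → e ∈ fibre z → ∃[ e′ ] e′ ∈ fibre z × e′ ≢ e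
    other z {e} m with _ , p , k ← ∈-filter⁻ (fibre? z) {xs = allFin _} m with e′ , ≢ , k′ , p′ ← partner e p =
      e′ , ∈-filter⁺ (fibre? z) (∈-allFin e′) (p′ , ≡.trans k′ k) , ≢

filter-split : {A : Set} {P Q R : A → Set} (P? : ∀ x → Dec (P x)) (Q? : ∀ x → Dec (Q x)) (R? : ∀ x → Dec (R x)) →
               (∀ {x} → P x → Q x ⊎ R x) → (∀ {x} → Q x → P x) → (∀ {x} → R x → P x) → (∀ {x} → Q x → R x → ⊥) →
               ∀ xs → filter P? xs ↭ filter Q? xs ++ filter R? xs
filter-split P? Q? R? p q r d []       = ↭-refl
filter-split P? Q? R? p q r d (x ∷ xs) with P? x | Q? x | R? x
... | _      | yes qx | yes rx = ⊥-elim (d qx rx)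
... | yes _  | yes _  | no _   = prep x (filter-split P? Q? R? p q r d xs)
... | yes _  | no _   | yes _  = ↭-trans (prep x (filter-split P? Q? R? p q r d xs)) (↭-sym (shift x (filter Q? xs) (filter R? xs)))
... | yes px | no ¬q  | no ¬r  with p px
...   | inj₁ qx = ⊥-elim (¬q qx)
...   | inj₂ rx = ⊥-elim (¬r rx)
filter-split P? Q? R? p q r d (x ∷ xs) | no ¬p | yes qx | no _ = ⊥-elim (¬p (q qx))
filter-split P? Q? R? p q r d (x ∷ xs) | no ¬p | no _ | yes rx = ⊥-elim (¬p (r rx))
filter-split P? Q? R? p q r d (x ∷ xs) | no _  | no _ | no _   = filter-split P? Q? R? p q r d xs

-- By `per-coeff` the rows that list the monomial `K` have nonzero permanent against `cs`. They are
-- arranged as the excess rows followed by `ts`, and the excess rows are expanded away together with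
-- `zs`. The component in `C` keeps track of where each form comes from.
per-forms : {C : Set} {n : ℕ} (cs : List (C × LinForm n)) (ts : List (Fin n)) (K : Monomial n) →
            coeff K (prod (map proj₂ cs)) ≢ 0ℤ → (∀ i → occ i ts ℕ.≤ lookup K i) →
            ∃[ zs ] ∃[ cs′ ] cs ↭ zs ++ cs′ × per (λ w (_ , ℓ) → coord ℓ w) ts cs′ ≢ 0ℤ
per-forms cs ts K h le with ss , ≡.refl ← count-complete ts K le =
  per-dropRows (λ w (_ , ℓ) → coord ℓ w) ss ts cs (λ z → *-≢0 (mult≢0 (ss ++ ts)) h
    (≡.trans (sym (per-coeff (map proj₂ cs) (ss ++ ts)))
    (≡.trans (cong (per coord (map proj₂ cs)) (sym (map-id (ss ++ ts))))
    (≡.trans (sym (per-map (λ (_ , ℓ) w → coord ℓ w) coord proj₂ (λ w → w) cs (ss ++ ts) (λ _ _ → ≡.refl)))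
    (≡.trans (per-transpose (λ (_ , ℓ) w → coord ℓ w) cs (ss ++ ts)) z)))))

-- The columns

module Construction {n : ℕ} (G : Graph n) (T : Fin n → Bool) (good-T : Independence.Good G T) where
  open Graph G
  open Independence G
  open Split T
  open Good good-T

  E : List Edge
  E = allFin ∣E∣

  -- Columns are integer combinations of edge variables, read as functions on
  -- the vertices through ⟦ x_{uv} ⟧ = indicator of {u , v}.
  Column : Set
  Column = LinForm ∣E∣

  χ : Edge → Fin n → ℤ
  χ s i = ℤ∑.𝟙 (i ≟ lower s) + ℤ∑.𝟙 (i ≟ upper s)

  ⟦_⟧ : Column → Fin n → ℤ
  ⟦ c ⟧ i = combine χ c i

  -- Up to sign the coefficient of the variable of `s` in the factor of `e`. The factor is oriented
  -- from `bot` to `top`, so that the order with `T` last governs all signs.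
  entry : Edge → Edge → ℤ
  entry s e = χ s (top e) - χ s (bot e)

  pairing : Edge → Column → ℤ
  pairing e c = combine entry c e

  pairing-⟦⟧ : ∀ e c → pairing e c ≡ ⟦ c ⟧ (top e) - ⟦ c ⟧ (bot e)
  pairing-⟦⟧ e []            = ≡.refl
  pairing-⟦⟧ e ((k , s) ∷ c) = ≡.trans (cong (k * entry s e +_) (pairing-⟦⟧ e c))
    (lemma k (χ s (top e)) (χ s (bot e)) (⟦ c ⟧ (top e)) (⟦ c ⟧ (bot e)))
    where
    lemma : ∀ k x y z w → k * (x - y) + (z - w) ≡ (k * x + z) - (k * y + w)
    lemma = solve-∀

  χ-joins : ∀ {s u v} i → Joins s u v → χ s i ≡ ℤ∑.𝟙 (i ≟ u) + ℤ∑.𝟙 (i ≟ v)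
  χ-joins i (inj₁ (≡.refl , ≡.refl)) = ≡.refl
  χ-joins {s} i (inj₂ (≡.refl , ≡.refl)) = ℤ.+-comm (ℤ∑.𝟙 (i ≟ lower s)) _

  χ-bot-top : ∀ s i → χ s i ≡ ℤ∑.𝟙 (i ≟ bot s) + ℤ∑.𝟙 (i ≟ top s)
  χ-bot-top s i = χ-joins i (joins-bot-top s)

  -- The order of the vertices and the chain columns

  rk : Fin n → ℕ
  rk v = if T v then n else toℕ v

  rk-T : ∀ {v} → T v ≡ true → rk v ≡ n
  rk-T h rewrite h = ≡.refl

  rk-∉T : ∀ {v} → T v ≡ false → rk v ≡ toℕ v
  rk-∉T h rewrite h = ≡.refl

  rk≤n : ∀ v → rk v ℕ.≤ n
  rk≤n v with T v
  ... | true  = ℕ.≤-refl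
  ... | false = ℕ.<⇒≤ (toℕ<n v)

  rk<n : ∀ {v} → T v ≡ false → rk v ℕ.< n
  rk<n {v} h = subst (ℕ._< n) (sym (rk-∉T h)) (toℕ<n v)

  rk<n⇒∉T : ∀ {v} → rk v ℕ.< n → T v ≡ false
  rk<n⇒∉T h = ¬-not (λ Tv → ℕ.<-irrefl (rk-T Tv) h)

  rk≡n⇒∈T : ∀ {v} → rk v ≡ n → T v ≡ true
  rk≡n⇒∈T h = ¬-not (λ Tv → ℕ.<-irrefl h (rk<n Tv))

  -- Outside `T` the rank is the number of the vertex. The bound is essential because all vertices
  -- of `T` share the rank `n`.
  rk-injective : ∀ {u v} → rk u ℕ.< n → rk u ≡ rk v → u ≡ v
  rk-injective h e = toℕ-injective (≡.trans (sym (rk-∉T (rk<n⇒∉T h)))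
    (≡.trans e (rk-∉T (rk<n⇒∉T (subst (ℕ._< n) e h)))))

  rk-bot<top : ∀ e → rk (bot e) ℕ.< rk (top e)
  rk-bot<top e with T (top e) in eq
  ... | true  = rk<n (bot∉T independent e)
  ... | false = subst (ℕ._< toℕ (top e)) (sym (rk-∉T (bot∉T independent e))) (lemma eq)
    where
    lemma : T (top e) ≡ false → toℕ (bot e) ℕ.< toℕ (top e)
    lemma h with T (lower e) in eq′
    ... | true  = ⊥-elim (true≢false (≡.trans (sym eq′) h))
    ... | false = ends-ordered e

  rank : Edge → ℕ
  rank e = rk (top e)

  later? : ∀ e e′ → Dec (bot e′ ≡ bot e × rank e ℕ.< rank e′)
  later? e e′ = (bot e′ ≟ bot e) ×-dec (rank e ℕ.<? rank e′)

  exit : Edge → Edge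
  exit e = proj₁ (dominating (bot e) (bot∉T independent e))

  -- The edge from `bot e` to its next neighbour after `top e`. The default `exit e` leads into `T`,
  -- so it is itself a later edge whenever `top e` lies outside `T`.
  next : Edge → Edge
  next e = argmin rank (exit e) (filter (later? e) E)

  next-later : ∀ e → rank e ℕ.< n → bot (next e) ≡ bot e × rank e ℕ.< rank (next e)
  next-later e h = argmin-all rank {⊤ = exit e} {xs = filter (later? e) E}
    {P = λ e′ → bot e′ ≡ bot e × rank e ℕ.< rank e′}
    (proj₁ spec , subst (rank e ℕ.<_) (sym (rk-T (proj₂ spec))) h) (All.all-filter (later? e) E)
    where spec = proj₂ (dominating (bot e) (bot∉T independent e))

  next-least : ∀ e e′ → bot e′ ≡ bot e → rank e ℕ.< rank e′ → rank (next e) ℕ.≤ rank e′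
  next-least e e′ b r = All.lookup (f[argmin]≤f[xs] {f = rank} (exit e) (filter (later? e) E))
    (∈-filter⁺ (later? e) (∈-allFin e′) (b , r))

  -- Equal successors force a common bottom. If the rank of `e` were smaller than that of `e′`, then
  -- `next e` would have rank at most that of `e′`, which is below that of `next e′`; the other case
  -- is symmetric.
  next-injective : ∀ {e e′} → rank e ℕ.< n → rank e′ ℕ.< n → next e ≡ next e′ → e ≡ e′
  next-injective {e} {e′} h h′ eq = edge-unique same (rk-injective h (ℕ.≤-antisym (ℕ.≮⇒≥ no-less′) (ℕ.≮⇒≥ no-less)))
    where
    same : bot e ≡ bot e′
    same = ≡.trans (sym (proj₁ (next-later e h))) (≡.trans (cong bot eq) (proj₁ (next-later e′ h′)))
    no-less : ¬ (rank e ℕ.< rank e′)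
    no-less lt = ℕ.<⇒≱ (proj₂ (next-later e′ h′)) (subst (λ g → rank g ℕ.≤ rank e′) eq (next-least e e′ (sym same) lt))
    no-less′ : ¬ (rank e′ ℕ.< rank e)
    no-less′ lt = ℕ.<⇒≱ (proj₂ (next-later e h)) (subst (λ g → rank g ℕ.≤ rank e) (sym eq) (next-least e′ e same lt))

  chain : Edge → Column
  chain e = (1ℤ , e) ∷ (-1ℤ , next e) ∷ []

  ⟦difference⟧ : ∀ {e e′} → bot e ≡ bot e′ → ∀ i →
                 ⟦ (1ℤ , e) ∷ (-1ℤ , e′) ∷ [] ⟧ i ≡ ℤ∑.𝟙 (i ≟ top e) - ℤ∑.𝟙 (i ≟ top e′)
  ⟦difference⟧ {e} {e′} b i = ≡.trans (cong₂ (λ x y → 1ℤ * x + (-1ℤ * y + 0ℤ)) (χ-bot-top e i)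
      (≡.trans (χ-bot-top e′ i) (cong (λ z → ℤ∑.𝟙 (i ≟ z) + ℤ∑.𝟙 (i ≟ top e′)) (sym b))))
    (lemma (ℤ∑.𝟙 (i ≟ bot e)) (ℤ∑.𝟙 (i ≟ top e)) (ℤ∑.𝟙 (i ≟ top e′)))
    where
    lemma : ∀ x y z → 1ℤ * (x + y) + (-1ℤ * (x + z) + 0ℤ) ≡ y - z
    lemma = solve-∀

  𝟙-rk< : ∀ {u v} → rk u ℕ.< rk v → ℤ∑.𝟙 (u ≟ v) ≡ 0ℤ
  𝟙-rk< {u} {v} h = ℤ∑.𝟙-no (u ≟ v) (λ { ≡.refl → ℕ.<-irrefl ≡.refl h })

  -- The chain acts as the difference of the variables at `top e` and `top (next e)`. Since rk (bot
  -- r) < rk (top r) ≤ rk (top e) < rk (top (next e)), only `top r` and `top e` can coincide.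
  pairing-chain : ∀ r e → rank r ℕ.≤ rank e → rank e ℕ.< n → pairing r (chain e) ≡ ℤ∑.𝟙 (top r ≟ top e)
  pairing-chain r e le lt = begin
    pairing r (chain e)
      ≡⟨ pairing-⟦⟧ r (chain e) ⟩
    ⟦ chain e ⟧ (top r) - ⟦ chain e ⟧ (bot r)
      ≡⟨ cong₂ _-_ (⟦difference⟧ b (top r)) (⟦difference⟧ b (bot r)) ⟩
    (ℤ∑.𝟙 (top r ≟ top e) - ℤ∑.𝟙 (top r ≟ top (next e))) - (ℤ∑.𝟙 (bot r ≟ top e) - ℤ∑.𝟙 (bot r ≟ top (next e)))
      ≡⟨ cong₂ _-_ (cong (λ z → ℤ∑.𝟙 (top r ≟ top e) - z) (𝟙-rk< (ℕ.≤-<-trans le later)))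
           (cong₂ _-_ (𝟙-rk< (ℕ.<-≤-trans (rk-bot<top r) le)) (𝟙-rk< (ℕ.<-trans (ℕ.<-≤-trans (rk-bot<top r) le) later))) ⟩
    (ℤ∑.𝟙 (top r ≟ top e) - 0ℤ) - (0ℤ - 0ℤ)
      ≡⟨ lemma (ℤ∑.𝟙 (top r ≟ top e)) ⟩
    ℤ∑.𝟙 (top r ≟ top e) ∎
    where
    open ≡-Reasoning
    b = sym (proj₁ (next-later e lt))
    later = proj₂ (next-later e lt)
    lemma : ∀ x → (x - 0ℤ) - (0ℤ - 0ℤ) ≡ x
    lemma = solve-∀

  level : ℕ → List Edge
  level k = filter (λ e → rank e ℕ.≟ k) E

  ∈-level : ∀ {k e} → e ∈ level k → rank e ≡ k
  ∈-level {k} m = proj₂ (∈-filter⁻ (λ e → rank e ℕ.≟ k) {xs = E} m)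

  -- The edges outside T, sorted by rank from k on; j levels remain.
  inner : ℕ → ℕ → List Edge
  inner k zero    = []
  inner k (suc j) = level k ++ inner (suc k) j

  inner-rank : ∀ k j → k ℕ.+ j ≡ n → All (λ e → k ℕ.≤ rank e × rank e ℕ.< n) (inner k j)
  inner-rank k zero    eq = []
  inner-rank k (suc j) eq = All.++⁺
    (All.tabulate (λ m → ℕ.≤-reflexive (sym (∈-level m)) , subst (ℕ._< n) (sym (∈-level m)) k<n))
    (All.map (λ (le , lt) → ℕ.<⇒≤ le , lt) (inner-rank (suc k) j (≡.trans (sym (ℕ.+-suc k j)) eq)))
    where
    k<n : k ℕ.< n
    k<n = subst (k ℕ.<_) eq (ℕ.m<m+n k ℕ.z<s)

  inner-↭ : ∀ k j → k ℕ.+ j ≡ n → filter (λ e → k ℕ.≤? rank e) E ↭ inner k j ++ level n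
  -- With no levels remaining `k` is `n`, and ranks never exceed `n`, so exactly the last level is
  -- left.
  inner-↭ k zero    eq rewrite ≡.trans (sym (ℕ.+-identityʳ k)) eq =
    ↭-trans (filter-split (λ e → n ℕ.≤? rank e) (λ e → rank e ℕ.≟ n) (λ e → n ℕ.<? rank e)
      (λ {e} h → inj₁ (ℕ.≤-antisym (rk≤n (top e)) h)) (ℕ.≤-reflexive ∘ sym) ℕ.<⇒≤
      (λ {e} _ h → ℕ.<⇒≱ h (rk≤n (top e))) E)
    (subst (λ z → level n ++ z ↭ level n) (sym empty) (↭-reflexive (++-identityʳ (level n))))
    where
    empty : filter (λ e → n ℕ.<? rank e) E ≡ []
    empty = filter-none (λ e → n ℕ.<? rank e) (All.tabulate {xs = E} (λ {e} _ h → ℕ.<⇒≱ h (rk≤n (top e))))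
  inner-↭ k (suc j) eq = ↭-trans
    (filter-split (λ e → k ℕ.≤? rank e) (λ e → rank e ℕ.≟ k) (λ e → suc k ℕ.≤? rank e)
      split (ℕ.≤-reflexive ∘ sym) ℕ.<⇒≤ (λ e h → ℕ.<-irrefl (sym e) h) E)
    (↭-trans (++⁺ˡ (level k) (inner-↭ (suc k) j (≡.trans (sym (ℕ.+-suc k j)) eq)))
      (↭-reflexive (sym (++-assoc (level k) (inner (suc k) j) (level n)))))
    where
    split : ∀ {e} → k ℕ.≤ rank e → rank e ≡ k ⊎ k ℕ.< rank e
    split h with ℕ.m≤n⇒m<n∨m≡n h
    ... | inj₁ lt = inj₂ lt
    ... | inj₂ eq = inj₁ (sym eq)

  E-↭ : E ↭ inner 0 n ++ level n
  E-↭ = ↭-trans (↭-reflexive (sym (filter-all (λ e → 0 ℕ.≤? rank e) (All.tabulate {xs = E} (λ _ → ℕ.z≤n))))) (inner-↭ 0 n ≡.refl)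

  -- The rows of level k have entry 1 at their own chains, since equal ranks below `n` mean equal
  -- tops. They vanish on the chains of higher levels and on `cs`, since both ends of such a row lie
  -- outside `T`. Thus `per-block` peels off one level at a time.
  per-chains : ∀ (cs : List Column) → All (λ c → ∀ i → T i ≡ false → ⟦ c ⟧ i ≡ 0ℤ) cs →
               per pairing (level n) cs ≢ 0ℤ → ∀ k j → k ℕ.+ j ≡ n →
               per pairing (inner k j ++ level n) (map chain (inner k j) ++ cs) ≢ 0ℤ
  per-chains cs zeros h k zero    eq = h
  per-chains cs zeros h k (suc j) eq z =
    *-≢0 {pos (length (level k) !)} (λ w → ℕ.<⇒≢ (ℕ.1≤n! (length (level k))) (sym (ℤ.+-injective w)))
      (per-chains cs zeros h (suc k) j eq′)
      (≡.trans (sym (per-block pairing (level k) (inner (suc k) j ++ level n) (map chain (level k)) (map chain (inner (suc k) j) ++ cs)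
        (sym (length-map chain (level k))) one nil)) (≡.trans (cong₂ (per pairing) (sym (++-assoc (level k) _ _))
          (≡.trans (sym (++-assoc (map chain (level k)) _ _)) (cong (_++ cs) (sym (map-++ chain (level k) (inner (suc k) j))))))
        z))
    where
    eq′ = ≡.trans (sym (ℕ.+-suc k j)) eq
    k<n : k ℕ.< n
    k<n = subst (k ℕ.<_) eq (ℕ.m<m+n k ℕ.z<s)
    one : ∀ {r c} → r ∈ level k → c ∈ map chain (level k) → pairing r c ≡ 1ℤ
    one {r} r∈ c∈ with e , e∈ , ≡.refl ← ∈-map⁻ chain c∈ =
      ≡.trans (pairing-chain r e (ℕ.≤-reflexive same) e<n) (ℤ∑.𝟙-yes (top r ≟ top e) (rk-injective (subst (ℕ._< n) (sym (∈-level r∈)) k<n) same))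
      where
      same : rank r ≡ rank e
      same = ≡.trans (∈-level r∈) (sym (∈-level e∈))
      e<n : rank e ℕ.< n
      e<n = subst (ℕ._< n) (sym (∈-level e∈)) k<n
    nil : ∀ {r d} → r ∈ level k → d ∈ map chain (inner (suc k) j) ++ cs → pairing r d ≡ 0ℤ
    nil {r} {d} r∈ d∈ with ∈-++⁻ (map chain (inner (suc k) j)) d∈
    ... | inj₁ d∈₁ with e , e∈ , ≡.refl ← ∈-map⁻ chain d∈₁ =
      ≡.trans (pairing-chain r e (ℕ.<⇒≤ r<e) (proj₂ bounds)) (𝟙-rk< r<e)
      where
      bounds = All.lookup (inner-rank (suc k) j eq′) e∈
      r<e : rank r ℕ.< rank e
      r<e = subst (ℕ._< rank e) (sym (∈-level r∈)) (proj₁ bounds)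
    ... | inj₂ d∈₂ = ≡.trans (pairing-⟦⟧ r d) (cong₂ _-_ (vanish (top r) (rk<n⇒∉T (subst (ℕ._< n) (sym (∈-level r∈)) k<n)))
                                                 (vanish (bot r) (bot∉T independent r)))
      where vanish = All.lookup zeros d∈₂

  -- Edges into the independent set and their columns

  Shared Private Crowded Lone : Edge → Set
  Shared e  = T (top e) ≡ true × 2 ℕ.≤ t (bot e)
  Private e = T (top e) ≡ true × t (bot e) ≡ 1
  Crowded e = Private e × ∃[ e′ ] (e′ ≢ e × top e′ ≡ top e × Private e′)
  Lone e    = Private e × ¬ (∃[ e′ ] (e′ ≢ e × top e′ ≡ top e × Private e′))

  shared? : ∀ e → Dec (Shared e)
  shared? e = (T (top e) Bool.≟ true) ×-dec (2 ℕ.≤? t (bot e))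

  private? : ∀ e → Dec (Private e)
  private? e = (T (top e) Bool.≟ true) ×-dec (t (bot e) ℕ.≟ 1)

  rival? : ∀ e → Dec (∃[ e′ ] (e′ ≢ e × top e′ ≡ top e × Private e′))
  rival? e = any? (λ e′ → ¬? (e′ ≟ e) ×-dec (top e′ ≟ top e) ×-dec private? e′)

  crowded? : ∀ e → Dec (Crowded e)
  crowded? e = private? e ×-dec rival? e

  lone? : ∀ e → Dec (Lone e)
  lone? e = private? e ×-dec ¬? (rival? e)

  shared-partner : ∀ e → Shared e → ∃[ e′ ] e′ ≢ e × bot e′ ≡ bot e × Shared e′
  shared-partner e (Tw , two) with any? (λ e′ → ¬? (e′ ≟ e) ×-dec leaves? (bot e) e′)
  ... | yes (e′ , e′≢e , b , Tw′) = e′ , e′≢e , b , Tw′ , subst (λ z → 2 ℕ.≤ t z) (sym b) two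
  ... | no none = ⊥-elim (ℕ.<-irrefl (sym single) two)
    where
    single : t (bot e) ≡ 1
    single = length-filter-unique (leaves? (bot e)) e (≡.refl , Tw)
      (λ x lx → decidable-stable (x ≟ e) (λ x≢e → none (x , x≢e , lx)))

  crowded-partner : ∀ e → Crowded e → ∃[ e′ ] e′ ≢ e × top e′ ≡ top e × Crowded e′
  crowded-partner e (pe , e′ , e′≢e , et , pe′) = e′ , e′≢e , et , pe′ , e , e′≢e ∘ sym , sym et , pe

  -- Shared edges are joined around their common vertex outside `T` and give differences; crowded
  -- edges are joined around their common vertex of `T` and give doubled variables. A lone edge
  -- starts no column; the surplus of the shared edges covers its row.
  module H = Cycles bot shared? shared-partner
  module C = Cycles top crowded? crowded-partner

  -- The default `e` makes the function total. For the pairs in a cycle of crowded edges the clique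
  -- property supplies the edge between the two bottoms.
  link : Edge → Edge → Edge
  link e e′ with any? (λ g → joins? g (bot e) (bot e′))
  ... | yes (g , _) = g
  ... | no _        = e

  joins-link : ∀ {e e′} → Crowded e → Crowded e′ → top e ≡ top e′ → e ≢ e′ → Joins (link e e′) (bot e) (bot e′)
  joins-link {e} {e′} ((Tw , one) , _) ((_ , one′) , _) et e≢e′ with any? (λ g → joins? g (bot e) (bot e′))
  ... | yes (_ , j) = j
  ... | no none     = ⊥-elim (none (clique e e′ e≢e′ et Tw one one′))

  crowdedColumn sharedColumn : Edge × Edge → Column × LinForm n
  crowdedColumn (e , e′) = ((1ℤ , e) ∷ (1ℤ , e′) ∷ (-1ℤ , link e e′) ∷ []) , double (top e)
  sharedColumn  (e , e′) = ((1ℤ , e) ∷ (-1ℤ , e′) ∷ []) , difference (top e , top e′)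

  -- The combination of edge variables acts on the vertices as the form paired with it, and this
  -- form involves only vertices of `T`.
  Faithful : Column × LinForm n → Set
  Faithful (c , ℓ) = (∀ i → ⟦ c ⟧ i ≡ coord ℓ i) × (∀ i → T i ≡ false → coord ℓ i ≡ 0ℤ)

  𝟙-sym : ∀ (i j : Fin n) → ℤ∑.𝟙 (i ≟ j) ≡ ℤ∑.𝟙 (j ≟ i)
  𝟙-sym i j = ℤ∑.𝟙-⇔ (i ≟ j) (j ≟ i) sym sym

  𝟙-∉T : ∀ {i w} → T w ≡ true → T i ≡ false → ℤ∑.𝟙 (w ≟ i) ≡ 0ℤ
  𝟙-∉T {i} {w} Tw Ti = ℤ∑.𝟙-no (w ≟ i) (λ { ≡.refl → true≢false (≡.trans (sym Tw) Ti) })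

  shared-faithful : ∀ {e e′} → Shared e → Shared e′ → bot e ≡ bot e′ → Faithful (sharedColumn (e , e′))
  shared-faithful {e} {e′} (Tw , _) (Tw′ , _) b =
    (λ i → ≡.trans (⟦difference⟧ b i) (≡.trans (cong₂ _-_ (𝟙-sym i (top e)) (𝟙-sym i (top e′)))
      (lemma (ℤ∑.𝟙 (top e ≟ i)) (ℤ∑.𝟙 (top e′ ≟ i))))) ,
    (λ i Ti → cong₂ (λ x y → 1ℤ * x + (-1ℤ * y + 0ℤ)) (𝟙-∉T Tw Ti) (𝟙-∉T Tw′ Ti))
    where
    lemma : ∀ x y → x - y ≡ 1ℤ * x + (-1ℤ * y + 0ℤ)
    lemma = solve-∀

  crowded-faithful : ∀ {e e′} → Crowded e → Crowded e′ → top e ≡ top e′ → e ≢ e′ → Faithful (crowdedColumn (e , e′))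
  crowded-faithful {e} {e′} ce@((Tw , _) , _) ce′ et e≢e′ =
    (λ i → ≡.trans (cong₂ (λ x y → 1ℤ * x + y) (χ-bot-top e i)
        (cong₂ (λ y z → 1ℤ * y + (-1ℤ * z + 0ℤ)) (≡.trans (χ-bot-top e′ i) (cong (λ w → ℤ∑.𝟙 (i ≟ bot e′) + ℤ∑.𝟙 (i ≟ w)) (sym et)))
          (χ-joins i (joins-link ce ce′ et e≢e′))))
      (≡.trans (lemma (ℤ∑.𝟙 (i ≟ bot e)) (ℤ∑.𝟙 (i ≟ bot e′)) (ℤ∑.𝟙 (i ≟ top e)))
        (cong (λ x → pos 2 * x + 0ℤ) (𝟙-sym i (top e))))) ,
    (λ i Ti → cong (λ x → pos 2 * x + 0ℤ) (𝟙-∉T Tw Ti))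
    where
    lemma : ∀ x y z → 1ℤ * (x + z) + (1ℤ * (y + z) + (-1ℤ * (x + y) + 0ℤ)) ≡ pos 2 * z + 0ℤ
    lemma = solve-∀

  -- The shared columns are listed twice so that the product of their forms is a square, as
  -- `center-coeff≢0` requires.
  columns : List (Column × LinForm n)
  columns = map crowdedColumn C.pairs ++ map sharedColumn H.pairs ++ map sharedColumn H.pairs

  columns-faithful : All Faithful columns
  columns-faithful = All.++⁺ (All.map⁺ (All.map (λ (c , c′ , et , ≢) → crowded-faithful c c′ et ≢) C.pairs-All))
    (All.++⁺ shared shared)
    where
    shared : All Faithful (map sharedColumn H.pairs)
    shared = All.map⁺ (All.map (λ (s , s′ , b , _) → shared-faithful s s′ b) H.pairs-All)

  tops : List (Edge × Edge) → List (Fin n × Fin n)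
  tops = map (λ (e , e′) → top e , top e′)

  γ : Monomial n
  γ = count (map (top ∘ proj₁) C.pairs) ⊕ center (tops H.pairs)

  forms : map proj₂ columns ≡ map double (map (top ∘ proj₁) C.pairs) ++ differences (tops H.pairs) ++ differences (tops H.pairs)
  forms = ≡.trans (map-++ proj₂ (map crowdedColumn C.pairs) _) (cong₂ _++_
    (≡.trans (sym (map-∘ C.pairs)) (map-∘ C.pairs))
    (≡.trans (map-++ proj₂ (map sharedColumn H.pairs) _) (cong₂ _++_ shared shared)))
    where
    shared : map proj₂ (map sharedColumn H.pairs) ≡ differences (tops H.pairs)
    shared = ≡.trans (sym (map-∘ H.pairs)) (map-∘ H.pairs)

  coeff-γ : coeff γ (prod (map proj₂ columns)) ≢ 0ℤ
  coeff-γ = subst (λ F → coeff γ (prod F) ≢ 0ℤ) (sym forms) (center-coeff≢0 (map (top ∘ proj₁) C.pairs) (tops H.pairs)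
    -- Different edges with the same bottom have different tops, so none of the differences is zero.
    (All.map⁺ (All.map (λ (_ , _ , b , e≢e′) et → e≢e′ (edge-unique b et)) H.pairs-All)))

  at : Fin n → Edge → ℕ
  at i e = 𝟙 (i ≟ top e)

  -- A crowded edge counts once at its top. A shared edge counts twice, as the first component of
  -- one pair and as the second component of another.
  lookup-γ : ∀ i → lookup γ i ≡ ∑ E (λ e → 𝟙 (crowded? e) ℕ.* at i e) ℕ.+
                                (∑ E (λ e → 𝟙 (shared? e) ℕ.* at i e) ℕ.+ ∑ E (λ e → 𝟙 (shared? e) ℕ.* at i e))
  lookup-γ i = begin
    lookup γ i
      ≡⟨ lookup-zipWith ℕ._+_ i (count (map (top ∘ proj₁) C.pairs)) (center (tops H.pairs)) ⟩
    lookup (count (map (top ∘ proj₁) C.pairs)) i ℕ.+ lookup (center (tops H.pairs)) i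
      ≡⟨ cong₂ ℕ._+_ (≡.trans (lookup-count i (map (top ∘ proj₁) C.pairs))
             (≡.trans (ℕ∑.∑-map (top ∘ proj₁) C.pairs _) (C.∑-pairs₁ (at i))))
           (≡.trans (lookup-zipWith ℕ._+_ i (count (map proj₁ (tops H.pairs))) (count (map proj₂ (tops H.pairs))))
             (cong₂ ℕ._+_
               (≡.trans (lookup-count i (map proj₁ (tops H.pairs))) (≡.trans (ℕ∑.∑-map proj₁ (tops H.pairs) _)
                 (≡.trans (ℕ∑.∑-map _ H.pairs _) (H.∑-pairs₁ (at i)))))
               (≡.trans (lookup-count i (map proj₂ (tops H.pairs))) (≡.trans (ℕ∑.∑-map proj₂ (tops H.pairs) _)
                 (≡.trans (ℕ∑.∑-map _ H.pairs _) (H.∑-pairs₂ (at i))))))) ⟩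
    _ ∎
    where open ≡-Reasoning

  classify : ∀ e → T (top e) ≡ true → Crowded e ⊎ Shared e ⊎ Lone e
  classify e Tw with shared? e
  ... | yes s = inj₂ (inj₁ s)
  ... | no ¬s = cases (rival? e)
    where
    one : t (bot e) ≡ 1
    -- The edge `e` is itself counted by `t (bot e)`, which is therefore at least 1.
    one = ℕ.≤-antisym (ℕ.≮⇒≥ (λ h → ¬s (Tw , h)))
      (ℕ.≤-trans (term≤∑ (λ _ → 1) (∈-T-edges ≡.refl Tw)) (ℕ.≤-reflexive (sym (length-∑ (T-edges (bot e))))))
    cases : Dec (∃[ e′ ] (e′ ≢ e × top e′ ≡ top e × Private e′)) → Crowded e ⊎ Shared e ⊎ Lone e
    cases (yes r) = inj₁ ((Tw , one) , r)
    cases (no ¬r) = inj₂ (inj₂ ((Tw , one) , ¬r))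

  -- Two lone edges with the same top would be rivals, so there is at most one. If there is one,
  -- `another` yields a second edge with that top; it is not private, or it would be a rival, and
  -- hence it is shared.
  lone≤shared : ∀ i → ∑ E (λ e → 𝟙 (lone? e) ℕ.* at i e) ℕ.≤ ∑ E (λ e → 𝟙 (shared? e) ℕ.* at i e)
  lone≤shared i with any? (λ e → lone? e ×-dec (i ≟ top e))
  ... | no none = ℕ.≤-trans (ℕ.≤-reflexive (ℕ∑.∑-zero-∈ E (λ {e} _ →
          ≡.trans (𝟙-× (lone? e) (i ≟ top e)) (ℕ∑.𝟙-no (lone? e ×-dec (i ≟ top e)) (λ h → none (e , h)))))) ℕ.z≤n
  ... | yes (e , (pe@(Tw , one) , ¬r) , ≡.refl) = ℕ.≤-trans
      (ℕ.≤-trans (ℕ.≤-reflexive (ℕ∑.∑-cong E (λ x → 𝟙-× (lone? x) (i ≟ top x))))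
        (∑-at-most-one (λ x → lone? x ×-dec (i ≟ top x))
          (λ {x} {y} ((px , ¬rx) , tx) ((py , _) , ty) → decidable-stable (x ≟ y)
            (λ x≢y → ¬rx (y , x≢y ∘ sym , ≡.trans (sym ty) tx , py)))))
      (ℕ.≤-trans (ℕ.≤-reflexive (sym (cong₂ ℕ._*_ (ℕ∑.𝟙-yes (shared? e′) shared) (ℕ∑.𝟙-yes (i ≟ top e′) (sym et)))))
        (term≤∑ (λ e → 𝟙 (shared? e) ℕ.* at i e) (∈-allFin e′)))
    where
    other = another e Tw one
    e′ = proj₁ other
    et : top e′ ≡ top e
    et = proj₂ (proj₂ other)
    shared : Shared e′
    shared with classify e′ (subst (λ z → T z ≡ true) (sym et) Tw)
    ... | inj₁ (pr , _)        = ⊥-elim (¬r (e′ , proj₁ (proj₂ other) , et , pr))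
    ... | inj₂ (inj₁ s)       = s
    ... | inj₂ (inj₂ (pr , _)) = ⊥-elim (¬r (e′ , proj₁ (proj₂ other) , et , pr))

  -- Each edge into `i` is crowded, shared or lone, and the lone ones are covered by the second
  -- count of the shared ones in `γ`.
  occ-level≤γ : ∀ i → occ i (map top (level n)) ℕ.≤ lookup γ i
  occ-level≤γ i = begin
    occ i (map top (level n))
      ≡⟨ ℕ∑.∑-map top (level n) _ ⟩
    ∑ (level n) (at i)
      ≡⟨ ℕ∑.∑-filter (λ e → rank e ℕ.≟ n) E (at i) ⟩
    ∑ E (λ e → 𝟙 (rank e ℕ.≟ n) ℕ.* at i e)
      ≤⟨ ∑-mono-∈ E (λ {e} _ → pointwise e) ⟩
    ∑ E (λ e → 𝟙 (crowded? e) ℕ.* at i e ℕ.+ (𝟙 (shared? e) ℕ.* at i e ℕ.+ 𝟙 (lone? e) ℕ.* at i e))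
      ≡⟨ ≡.trans (ℕ∑.∑-+ E _ _) (cong (∑ E (λ e → 𝟙 (crowded? e) ℕ.* at i e) ℕ.+_) (ℕ∑.∑-+ E _ _)) ⟩
    ∑ E (λ e → 𝟙 (crowded? e) ℕ.* at i e) ℕ.+ (∑ E (λ e → 𝟙 (shared? e) ℕ.* at i e) ℕ.+ ∑ E (λ e → 𝟙 (lone? e) ℕ.* at i e))
      ≤⟨ ℕ.+-monoʳ-≤ (∑ E (λ e → 𝟙 (crowded? e) ℕ.* at i e)) (ℕ.+-monoʳ-≤ (∑ E (λ e → 𝟙 (shared? e) ℕ.* at i e)) (lone≤shared i)) ⟩
    _ ≡⟨ lookup-γ i ⟨
    lookup γ i ∎
    where
    open ℕ.≤-Reasoning
    pointwise : ∀ e → 𝟙 (rank e ℕ.≟ n) ℕ.* at i e ℕ.≤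
                      𝟙 (crowded? e) ℕ.* at i e ℕ.+ (𝟙 (shared? e) ℕ.* at i e ℕ.+ 𝟙 (lone? e) ℕ.* at i e)
    pointwise e = by (rank e ℕ.≟ n)
      where
      c = 𝟙 (crowded? e) ℕ.* at i e
      s = 𝟙 (shared? e) ℕ.* at i e
      l = 𝟙 (lone? e) ℕ.* at i e
      full : ∀ {P : Set} (d : Dec P) → P → 1 ℕ.* at i e ℕ.≤ 𝟙 d ℕ.* at i e
      full d h = ℕ.*-monoˡ-≤ (at i e) (ℕ.≤-reflexive (sym (ℕ∑.𝟙-yes d h)))
      by : (d : Dec (rank e ≡ n)) → 𝟙 d ℕ.* at i e ℕ.≤ c ℕ.+ (s ℕ.+ l)
      by (no _)  = ℕ.z≤n
      by (yes r) with classify e (rk≡n⇒∈T r)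
      ... | inj₁ h        = ℕ.≤-trans (full (crowded? e) h) (ℕ.m≤m+n c _)
      ... | inj₂ (inj₁ h) = ℕ.≤-trans (full (shared? e) h) (ℕ.≤-trans (ℕ.m≤m+n s l) (ℕ.m≤n+m _ c))
      ... | inj₂ (inj₂ h) = ℕ.≤-trans (full (lone? e) h) (ℕ.≤-trans (ℕ.m≤n+m l s) (ℕ.m≤n+m _ c))

  -- A row of the last level has its bottom outside `T`, where faithful columns vanish. Its entry is
  -- thus the coefficient of the form at the top, and `per-forms` selects the columns.
  T-block : ∃[ zs ] ∃[ cs ] columns ↭ zs ++ cs × per pairing (level n) (map proj₁ cs) ≢ 0ℤ
  T-block = finish (per-forms columns (map top (level n)) γ coeff-γ occ-level≤γ)
    where
    q : Fin n → Column × LinForm n → ℤ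
    q w (c , ℓ) = coord ℓ w
    same : ∀ {e} cℓ → Faithful cℓ → pairing e (proj₁ cℓ) ≡ q (top e) cℓ
    same {e} (c , ℓ) (f , z) = ≡.trans (pairing-⟦⟧ e c)
      (≡.trans (cong₂ _-_ (f (top e)) (≡.trans (f (bot e)) (z (bot e) (bot∉T independent e)))) (ℤ.+-identityʳ (coord ℓ (top e))))
    finish : ∃[ zs ] ∃[ cs ] columns ↭ zs ++ cs × per q (map top (level n)) cs ≢ 0ℤ →
             ∃[ zs ] ∃[ cs ] columns ↭ zs ++ cs × per pairing (level n) (map proj₁ cs) ≢ 0ℤ
    finish (zs , cs , r , h) = zs , cs , r , λ z → h (≡.trans
        (per-congʳ (per-map (λ e cℓ → pairing e (proj₁ cℓ)) q top (λ c → c) (level n) cs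
          (λ {e} {cℓ} _ c∈ → same {e} cℓ (All.lookup (All.++⁻ʳ zs (All-resp-↭ r columns-faithful)) c∈))))
        (≡.trans (per-map (λ e cℓ → pairing e (proj₁ cℓ)) pairing (λ e → e) proj₁ (level n) cs (λ _ _ → ≡.refl))
          (≡.trans (cong (λ L → per pairing L (map proj₁ cs)) (map-id (level n))) z)))
      where
      per-congʳ : ∀ {x} → x ≡ per q (map top (level n)) (map (λ c → c) cs) → per q (map top (level n)) cs ≡ x
      per-congʳ e = ≡.trans (cong (per q (map top (level n))) (sym (map-id cs))) (sym e)

  -- How often each variable occurs

  uses : Edge → Column → ℕ
  uses s c = ∑ c (λ (_ , e) → 𝟙 (s ≟ e))

  ∑-inner : ∀ φ → ∑ (inner 0 n) φ ≡ ∑ E (λ e → 𝟙 (rank e ℕ.<? n) ℕ.* φ e)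
  ∑-inner φ = sym (begin
    ∑ E φ′                               ≡⟨ ℕ∑.∑-↭ φ′ E-↭ ⟩
    ∑ (inner 0 n ++ level n) φ′          ≡⟨ ℕ∑.∑-++ (inner 0 n) (level n) φ′ ⟩
    ∑ (inner 0 n) φ′ ℕ.+ ∑ (level n) φ′  ≡⟨ cong₂ ℕ._+_
      (ℕ∑.∑-cong-∈ (inner 0 n) (λ {e} m → ≡.trans (cong (ℕ._* φ e) (ℕ∑.𝟙-yes (rank e ℕ.<? n) (proj₂ (All.lookup (inner-rank 0 n ≡.refl) m)))) (ℕ.*-identityˡ (φ e))))
      (ℕ∑.∑-zero-∈ (level n) (λ {e} m → cong (ℕ._* φ e) (ℕ∑.𝟙-no (rank e ℕ.<? n) (ℕ.<-irrefl (∈-level m))))) ⟩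
    ∑ (inner 0 n) φ ℕ.+ 0                ≡⟨ ℕ.+-identityʳ _ ⟩
    ∑ (inner 0 n) φ                      ∎)
    where
    open ≡-Reasoning
    φ′ : Edge → ℕ
    φ′ e = 𝟙 (rank e ℕ.<? n) ℕ.* φ e

  -- An edge occurs in its own chain if its top is outside `T`. By `next-injective` it is the
  -- subtracted edge of at most one chain.
  uses-chains : ∀ s → ∑ (map chain (inner 0 n)) (uses s) ℕ.≤ 𝟙 (rank s ℕ.<? n) ℕ.+ 1
  uses-chains s = begin
    ∑ (map chain (inner 0 n)) (uses s)
      ≡⟨ ℕ∑.∑-map chain (inner 0 n) (uses s) ⟩
    ∑ (inner 0 n) (λ e → 𝟙 (s ≟ e) ℕ.+ (𝟙 (s ≟ next e) ℕ.+ 0))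
      ≡⟨ ℕ∑.∑-+ (inner 0 n) (λ e → 𝟙 (s ≟ e)) (λ e → 𝟙 (s ≟ next e) ℕ.+ 0) ⟩
    ∑ (inner 0 n) (λ e → 𝟙 (s ≟ e)) ℕ.+ ∑ (inner 0 n) (λ e → 𝟙 (s ≟ next e) ℕ.+ 0)
      ≡⟨ cong₂ ℕ._+_ (≡.trans (∑-inner (λ e → 𝟙 (s ≟ e))) (∑-𝟙-≟ (λ e → rank e ℕ.<? n) s))
           (≡.trans (∑-inner (λ e → 𝟙 (s ≟ next e) ℕ.+ 0)) (ℕ∑.∑-cong E (λ e →
             ≡.trans (cong (𝟙 (rank e ℕ.<? n) ℕ.*_) (ℕ.+-identityʳ (𝟙 (s ≟ next e)))) (𝟙-× (rank e ℕ.<? n) (s ≟ next e))))) ⟩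
    𝟙 (rank s ℕ.<? n) ℕ.+ ∑ E (λ e → 𝟙 ((rank e ℕ.<? n) ×-dec (s ≟ next e)))
      ≤⟨ ℕ.+-monoʳ-≤ (𝟙 (rank s ℕ.<? n)) (∑-at-most-one (λ e → (rank e ℕ.<? n) ×-dec (s ≟ next e))
           (λ (h , e) (h′ , e′) → next-injective h h′ (≡.trans (sym e) e′))) ⟩
    𝟙 (rank s ℕ.<? n) ℕ.+ 1 ∎
    where open ℕ.≤-Reasoning

  links : Edge → ℕ
  links s = ∑ C.pairs (λ (e , e′) → 𝟙 (s ≟ link e e′))

  links-joins : ∀ {s e e′} → (e , e′) ∈ C.pairs → s ≡ link e e′ → Joins s (bot e) (bot e′)
  links-joins m ≡.refl with c , c′ , et , e≢e′ ← All.lookup C.pairs-All m = joins-link c c′ et e≢e′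

  -- If `s` links the pair of `e` and `e′`, then `bot e` is an end of `s`. Each end is the bottom of
  -- at most one crowded edge, because such edges are private, and that edge comes first in only one
  -- pair.
  links≤2 : ∀ s → links s ℕ.≤ 2
  links≤2 s = begin
    links s
      ≤⟨ ∑-mono-∈ C.pairs (λ {(e , e′)} m → bound m (s ≟ link e e′)) ⟩
    ∑ C.pairs (λ (e , e′) → from (lower s) e ℕ.+ from (upper s) e)
      ≡⟨ ℕ∑.∑-+ C.pairs (from (lower s) ∘ proj₁) (from (upper s) ∘ proj₁) ⟩
    ∑ C.pairs (from (lower s) ∘ proj₁) ℕ.+ ∑ C.pairs (from (upper s) ∘ proj₁)
      ≤⟨ ℕ.+-mono-≤ (from≤1 (lower s)) (from≤1 (upper s)) ⟩
    2 ∎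
    where
    open ℕ.≤-Reasoning
    from : Fin n → Edge → ℕ
    from v e = 𝟙 (bot e ≟ v)
    from≤1 : ∀ v → ∑ C.pairs (from v ∘ proj₁) ℕ.≤ 1
    from≤1 v = ℕ.≤-trans (ℕ.≤-reflexive (≡.trans (C.∑-pairs₁ (from v)) (ℕ∑.∑-cong E (λ e → 𝟙-× (crowded? e) (bot e ≟ v)))))
      (∑-at-most-one (λ e → crowded? e ×-dec (bot e ≟ v))
        (λ (((Tw , _) , _) , b) (((Tw′ , one′) , _) , b′) → T-edge-unique Tw′ one′ (≡.trans b (sym b′)) Tw))
    bound : ∀ {e e′} → (e , e′) ∈ C.pairs → (d : Dec (s ≡ link e e′)) → 𝟙 d ℕ.≤ from (lower s) e ℕ.+ from (upper s) e
    bound m (no _)   = ℕ.z≤n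
    bound {e} m (yes eq) with links-joins m eq
    ... | inj₁ (l , _) = ℕ.≤-trans (ℕ.≤-reflexive (sym (ℕ∑.𝟙-yes (bot e ≟ lower s) (sym l)))) (ℕ.m≤m+n _ _)
    ... | inj₂ (_ , u) = ℕ.≤-trans (ℕ.≤-reflexive (sym (ℕ∑.𝟙-yes (bot e ≟ upper s) (sym u)))) (ℕ.m≤n+m _ (from (lower s) e))

  -- A link joins two bottoms, and these lie outside `T`.
  links-T : ∀ s → T (top s) ≡ true → links s ≡ 0
  links-T s Tw = ℕ∑.∑-zero-∈ C.pairs (λ {(e , e′)} m → ℕ∑.𝟙-no (s ≟ link e e′) (λ eq → outside (links-joins m eq)))
    where
    clash : ∀ e → top s ≡ bot e → ⊥
    clash e eq = true≢false (≡.trans (sym Tw) (≡.trans (cong T eq) (bot∉T independent e)))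
    outside : ∀ {e e′} → Joins s (bot e) (bot e′) → ⊥
    outside {e} {e′} j with joins-bot-top s | j
    ... | inj₁ (_ , x) | inj₁ (_ , y) = clash e′ (≡.trans (sym x) y)
    ... | inj₁ (_ , x) | inj₂ (_ , y) = clash e  (≡.trans (sym x) y)
    ... | inj₂ (x , _) | inj₁ (y , _) = clash e  (≡.trans (sym x) y)
    ... | inj₂ (x , _) | inj₂ (y , _) = clash e′ (≡.trans (sym x) y)

  uses-columns : ∀ s → ∑ columns (uses s ∘ proj₁) ≡
                 (𝟙 (crowded? s) ℕ.+ (𝟙 (crowded? s) ℕ.+ links s)) ℕ.+
                 ((𝟙 (shared? s) ℕ.+ 𝟙 (shared? s)) ℕ.+ (𝟙 (shared? s) ℕ.+ 𝟙 (shared? s)))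
  uses-columns s = ≡.trans (ℕ∑.∑-++ (map crowdedColumn C.pairs) _ _) (cong₂ ℕ._+_
      (≡.trans (ℕ∑.∑-map crowdedColumn C.pairs _) (≡.trans (ℕ∑.∑-+ C.pairs (is ∘ proj₁) _)
        (cong₂ ℕ._+_ (≡.trans (C.∑-pairs₁ is) (∑-𝟙-≟ crowded? s)) (≡.trans (ℕ∑.∑-+ C.pairs (is ∘ proj₂) _)
          (cong₂ ℕ._+_ (≡.trans (C.∑-pairs₂ is) (∑-𝟙-≟ crowded? s)) (ℕ∑.∑-cong C.pairs (λ (e , e′) → ℕ.+-identityʳ _)))))))
      (≡.trans (ℕ∑.∑-++ (map sharedColumn H.pairs) _ _) (cong₂ ℕ._+_ shared shared)))
    where
    is : Edge → ℕ
    is e = 𝟙 (s ≟ e)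
    shared : ∑ (map sharedColumn H.pairs) (uses s ∘ proj₁) ≡ 𝟙 (shared? s) ℕ.+ 𝟙 (shared? s)
    shared = ≡.trans (ℕ∑.∑-map sharedColumn H.pairs _) (≡.trans (ℕ∑.∑-+ H.pairs (is ∘ proj₁) _)
      (cong₂ ℕ._+_ (≡.trans (H.∑-pairs₁ is) (∑-𝟙-≟ shared? s))
        (≡.trans (ℕ∑.∑-cong H.pairs (λ (e , e′) → ℕ.+-identityʳ (is e′))) (≡.trans (H.∑-pairs₂ is) (∑-𝟙-≟ shared? s)))))

  -- If the top of `s` is outside `T`, two chains and two links give at most 4. Otherwise there is
  -- at most one chain, and in addition four uses for a shared edge, two for a crowded one and none
  -- for a lone one. The shared edges attain 5.
  capacity : ∀ s → (𝟙 (rank s ℕ.<? n) ℕ.+ 1) ℕ.+ ∑ columns (uses s ∘ proj₁) ℕ.≤ 5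
  capacity s = ℕ.≤-trans (ℕ.≤-reflexive (cong (𝟙 (rank s ℕ.<? n) ℕ.+ 1 ℕ.+_) (uses-columns s))) (cases (T (top s) Bool.≟ true))
    where
    value : ∀ {r c l h r′ c′ l′ h′ : ℕ} → r ≡ r′ → c ≡ c′ → l ℕ.≤ l′ → h ≡ h′ →
            r ℕ.+ 1 ℕ.+ ((c ℕ.+ (c ℕ.+ l)) ℕ.+ ((h ℕ.+ h) ℕ.+ (h ℕ.+ h))) ℕ.≤
            r′ ℕ.+ 1 ℕ.+ ((c′ ℕ.+ (c′ ℕ.+ l′)) ℕ.+ ((h′ ℕ.+ h′) ℕ.+ (h′ ℕ.+ h′)))
    value {r} {c} {h = h} ≡.refl ≡.refl le ≡.refl =
      ℕ.+-monoʳ-≤ (r ℕ.+ 1) (ℕ.+-monoˡ-≤ _ (ℕ.+-monoʳ-≤ c (ℕ.+-monoʳ-≤ c le)))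
    cases : Dec (T (top s) ≡ true) → 𝟙 (rank s ℕ.<? n) ℕ.+ 1 ℕ.+ ((𝟙 (crowded? s) ℕ.+ (𝟙 (crowded? s) ℕ.+ links s)) ℕ.+
            ((𝟙 (shared? s) ℕ.+ 𝟙 (shared? s)) ℕ.+ (𝟙 (shared? s) ℕ.+ 𝟙 (shared? s)))) ℕ.≤ 5
    cases (no ∉T) = ℕ.≤-trans (value (ℕ∑.𝟙-yes (rank s ℕ.<? n) (rk<n (¬-not ∉T))) (ℕ∑.𝟙-no (crowded? s) (∉T ∘ proj₁ ∘ proj₁))
      (links≤2 s) (ℕ∑.𝟙-no (shared? s) (∉T ∘ proj₁))) (ℕ.n≤1+n 4)
    cases (yes ∈T) = at-T (shared? s) (crowded? s)
      where
      outer = ℕ∑.𝟙-no (rank s ℕ.<? n) (ℕ.<-irrefl (rk-T ∈T))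
      unlinked = ℕ.≤-reflexive (links-T s ∈T)
      at-T : Dec (Shared s) → Dec (Crowded s) → _
      at-T (yes sh) _        = value outer (ℕ∑.𝟙-no (crowded? s) (λ ((_ , one) , _) → ℕ.<-irrefl (sym one) (proj₂ sh))) unlinked (ℕ∑.𝟙-yes (shared? s) sh)
      at-T (no ¬sh) (yes cr) = ℕ.≤-trans (value outer (ℕ∑.𝟙-yes (crowded? s) cr) unlinked (ℕ∑.𝟙-no (shared? s) ¬sh)) (ℕ.m≤m+n 3 2)
      at-T (no ¬sh) (no ¬cr) = ℕ.≤-trans (value outer (ℕ∑.𝟙-no (crowded? s) ¬cr) unlinked (ℕ∑.𝟙-no (shared? s) ¬sh)) (ℕ.m≤m+n 1 4)

  nonvanishing-columns : ∃[ cs ] per pairing E cs ≢ 0ℤ × (∀ s → ∑ cs (uses s) ℕ.≤ 5)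
  nonvanishing-columns = assemble T-block
    where
    assemble : ∃[ zs ] ∃[ cs ] columns ↭ zs ++ cs × per pairing (level n) (map proj₁ cs) ≢ 0ℤ →
               ∃[ cs ] per pairing E cs ≢ 0ℤ × (∀ s → ∑ cs (uses s) ℕ.≤ 5)
    assemble (zs , cs , r , h) = map chain (inner 0 n) ++ map proj₁ cs ,
      subst (_≢ 0ℤ) (sym (per-↭ pairing E-↭ (map chain (inner 0 n) ++ map proj₁ cs))) (per-chains (map proj₁ cs) zeros h 0 n ≡.refl) ,
      bound
      where
      zeros : All (λ c → ∀ i → T i ≡ false → ⟦ c ⟧ i ≡ 0ℤ) (map proj₁ cs)
      zeros = All.map⁺ (All.map (λ (f , z) i Ti → ≡.trans (f i) (z i Ti)) (All.++⁻ʳ zs (All-resp-↭ r columns-faithful)))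
      bound : ∀ s → ∑ (map chain (inner 0 n) ++ map proj₁ cs) (uses s) ℕ.≤ 5
      bound s = begin
        ∑ (map chain (inner 0 n) ++ map proj₁ cs) (uses s)
          ≡⟨ ℕ∑.∑-++ (map chain (inner 0 n)) (map proj₁ cs) (uses s) ⟩
        ∑ (map chain (inner 0 n)) (uses s) ℕ.+ ∑ (map proj₁ cs) (uses s)
          ≤⟨ ℕ.+-mono-≤ (uses-chains s) (begin
               ∑ (map proj₁ cs) (uses s)          ≡⟨ ℕ∑.∑-map proj₁ cs (uses s) ⟩
               ∑ cs (uses s ∘ proj₁)              ≤⟨ ℕ.m≤n+m _ (∑ zs (uses s ∘ proj₁)) ⟩
               ∑ zs (uses s ∘ proj₁) ℕ.+ ∑ cs (uses s ∘ proj₁) ≡⟨ ℕ∑.∑-++ zs cs (uses s ∘ proj₁) ⟨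
               ∑ (zs ++ cs) (uses s ∘ proj₁)      ≡⟨ ℕ∑.∑-↭ (uses s ∘ proj₁) r ⟨
               ∑ columns (uses s ∘ proj₁)         ∎) ⟩
        (𝟙 (rank s ℕ.<? n) ℕ.+ 1) ℕ.+ ∑ columns (uses s ∘ proj₁)
          ≤⟨ capacity s ⟩
        5 ∎
        where open ℕ.≤-Reasoning

  -- Return to the graph polynomial

  factor : Edge → LinForm ∣E∣
  factor e = map (1ℤ ,_) E[ lower e ] ++ map (-1ℤ ,_) E[ upper e ]

  -- The graph polynomial subtracts the upper from the lower end, `entry` the bottom from the top.
  -- The two agree exactly when the top is the lower end.
  sign : Edge → ℤ
  sign e = if T (lower e) then 1ℤ else -1ℤ

  coord-star : ∀ k i s → coord (map (k ,_) E[ i ]) s ≡ k * χ s i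
  coord-star k i s = begin
    ℤ∑.∑ (map (k ,_) E[ i ]) (λ (c , t) → c * ℤ∑.𝟙 (t ≟ s))
      ≡⟨ ℤ∑.∑-map (k ,_) E[ i ] (λ (c , t) → c * ℤ∑.𝟙 (t ≟ s)) ⟩
    ℤ∑.∑ E[ i ] (λ t → k * ℤ∑.𝟙 (t ≟ s))
      ≡⟨ ℤ∑.∑-*ˡ E[ i ] k (λ t → ℤ∑.𝟙 (t ≟ s)) ⟩
    k * ℤ∑.∑ E[ i ] (λ t → ℤ∑.𝟙 (t ≟ s))
      ≡⟨ cong (k *_) (ℤ∑.∑-filter (incident? i) E (λ t → ℤ∑.𝟙 (t ≟ s))) ⟩
    k * ℤ∑.∑ E (λ t → ℤ∑.𝟙 (incident? i t) * ℤ∑.𝟙 (t ≟ s))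
      ≡⟨ cong (k *_) (ℤ∑.∑-cong E (λ t → ≡.trans (ℤ.*-comm (ℤ∑.𝟙 (incident? i t)) (ℤ∑.𝟙 (t ≟ s)))
           (cong (_* ℤ∑.𝟙 (incident? i t)) (ℤ∑.𝟙-⇔ (t ≟ s) (s ≟ t) sym sym)))) ⟩
    k * ℤ∑.∑ E (λ t → ℤ∑.𝟙 (s ≟ t) * ℤ∑.𝟙 (incident? i t))
      ≡⟨ cong (k *_) (ℤ∑.∑-𝟙≟ _≟_ (allFin⁺ ∣E∣) (∈-allFin s) (λ t → ℤ∑.𝟙 (incident? i t))) ⟩
    k * ℤ∑.𝟙 (incident? i s)
      ≡⟨ cong (k *_) (split (i ≟ lower s) (i ≟ upper s)) ⟩
    k * χ s i ∎
    where
    open ≡-Reasoning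
    split : (d : Dec (i ≡ lower s)) (d′ : Dec (i ≡ upper s)) → ℤ∑.𝟙 (d ⊎-dec d′) ≡ ℤ∑.𝟙 d + ℤ∑.𝟙 d′
    split (yes l) (yes u) = ⊥-elim (lower≢upper s (≡.trans (sym l) u))
    split (yes _) (no _)  = ≡.refl
    split (no _)  (yes _) = ≡.refl
    split (no _)  (no _)  = ≡.refl

  coord-factor : ∀ e s → entry s e ≡ sign e * coord (factor e) s
  coord-factor e s = ≡.trans orient (cong (sign e *_) (sym (begin
    coord (factor e) s
      ≡⟨ ℤ∑.∑-++ (map (1ℤ ,_) E[ lower e ]) (map (-1ℤ ,_) E[ upper e ]) (λ (c , t) → c * ℤ∑.𝟙 (t ≟ s)) ⟩
    coord (map (1ℤ ,_) E[ lower e ]) s + coord (map (-1ℤ ,_) E[ upper e ]) s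
      ≡⟨ cong₂ _+_ (coord-star 1ℤ (lower e) s) (coord-star -1ℤ (upper e) s) ⟩
    1ℤ * χ s (lower e) + -1ℤ * χ s (upper e) ∎)))
    where
    open ≡-Reasoning
    plus : ∀ x y → x - y ≡ 1ℤ * (1ℤ * x + -1ℤ * y)
    plus = solve-∀
    minus : ∀ x y → y - x ≡ -1ℤ * (1ℤ * x + -1ℤ * y)
    minus = solve-∀
    orient : entry s e ≡ sign e * (1ℤ * χ s (lower e) + -1ℤ * χ s (upper e))
    orient with T (lower e)
    ... | true  = plus (χ s (lower e)) (χ s (upper e))
    ... | false = minus (χ s (lower e)) (χ s (upper e))

  -- The two sides agree as lists of terms, before any cancellation, because `lin` turns the signed
  -- edges of a factor into precisely its terms.
  graphPoly-prod : graphPoly G ≡ prod (map factor E)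
  graphPoly-prod = cong productₚ (≡.trans (map-cong (λ e → sym (lin-factor e)) E) (map-∘ E))
    where
    lin-vertexSum : ∀ es → lin (map (1ℤ ,_) es) ≡ sumₚ (map var es)
    lin-vertexSum []       = ≡.refl
    lin-vertexSum (e ∷ es) = cong (_ ∷_) (lin-vertexSum es)
    lin-negated : ∀ es → lin (map (-1ℤ ,_) es) ≡ map (λ (c , K) → - c , K) (sumₚ (map var es))
    lin-negated []       = ≡.refl
    lin-negated (e ∷ es) = cong (_ ∷_) (lin-negated es)
    lin-factor : ∀ e → lin (factor e) ≡ vertexSum G (lower e) -ₚ vertexSum G (upper e)
    lin-factor e = ≡.trans (map-++ _ (map (1ℤ ,_) E[ lower e ]) _) (cong₂ _++_ (lin-vertexSum E[ lower e ]) (lin-negated E[ upper e ]))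

  choosable : G isAlgebraic[1, 6 ]Choosable
  choosable = conclude nonvanishing-columns
    where
    conclude : ∃[ cs ] per pairing E cs ≢ 0ℤ × (∀ s → ∑ cs (uses s) ℕ.≤ 5) → G isAlgebraic[1, 6 ]Choosable
    conclude (cs , h , bound) = select (per-select entry cs E (subst (_≢ 0ℤ) (per-transpose pairing E cs) h))
      where
      select : ∃[ ss ] per entry ss E ≢ 0ℤ × (∀ (μ : Edge → ℕ) → ∑ ss μ ℕ.≤ ∑ cs (λ c → ∑ c (μ ∘ proj₂))) → G isAlgebraic[1, 6 ]Choosable
      -- The exponents count the selected variables. A nonzero permanent is square, so there are as
      -- many of them as edges.
      select (ss , h′ , le) = count ss ,
        ≡.trans (sum-count ss) (≡.trans (per-length entry ss E h′) (length-tabulate (λ x → x))) ,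
        -- With the indicator of `s` as the measure, the bound says that `s` is selected at most as
        -- often as it occurs in the columns.
        (λ s → ℕ.≤-trans (ℕ.≤-reflexive (lookup-count s ss)) (ℕ.≤-trans (le (λ e → 𝟙 (s ≟ e))) (bound s))) ,
        λ z → h′ (≡.trans (per-transpose entry ss E)
          (≡.trans (per-scale (flip entry) coord sign factor (λ s → s) E ss (λ {e} {s} _ _ → coord-factor e s))
          (≡.trans (cong (∏ (map sign E) *_) (≡.trans (cong (per coord (map factor E)) (map-id ss))
            (≡.trans (per-coeff (map factor E) ss) (≡.trans (cong (mult ss *_) (≡.trans (cong (coeff (count ss)) (sym graphPoly-prod)) z)) (ℤ.*-zeroʳ (mult ss))))))
            (ℤ.*-zeroʳ (∏ (map sign E))))))

theorem4p1 : (n : ℕ) (G : Graph n) → Graph.Nice G → G isAlgebraic[1, 6 ]Choosable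
theorem4p1 n G nice = Construction.choosable G (proj₁ T) (proj₂ T)
  where T = Independence.good-set G nice
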